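{- Let $w\in S_n$ be $1432$-avoiding. Then $\Theta_w:\mathrm{SVRT}(w)\to\mathsf{KKoh}(w)$ is a weight-preserving bijection (i.e. $\mathrm{wt}(\Theta_w(T))=\mathrm{wt}(T)$ for all $T$) with inverse $\Xi_w$.
   Context: Cells of $[n]\times[n]$ are indexed in matrix notation: $(i,j)$ is row $i$ (from the top), column $j$ (from the left). A permutation $w$ is $1432$-avoiding if there are no indices $j_1<j_2<j_3<j_4$ with $w(j_1)<w(j_4)<w(j_3)<w(j_2)$. The Rothe diagram of $w\in S_n$ is $D(w)=\{(i,j)\in[n]^2: i<w^{ -1}(j),\ j<w(i)\}$. A grave diagram is a pair $E=(B,G)$ of disjoint subsets of $[n]\times[n]$; cells of $B$ are boxes, cells of $G$ are ghosts, cells of $B\cup G$ are occupied; $\mathrm{wt}(E)_i=\#\{j:(i,j)\in B\cup G\}$. Suppose $(i,j)\in B$ is rightmost among all occupied cells in row $i$; let $i'=\max\{r: 1\leq r<i,\ (r,j)\notin B\cup G\}$; assume $i'$ exists and every occupied cell $(r,j)$ with $i'<r\leq i$ is a box. The ordinary Kohnert move at row $i$ is $(B,G)\mapsto((B\setminus\{(i,j)\})\cup\{(i',j)\},G)$; the $K$-Kohnert move at row $i$ is $(B,G)\mapsto((B\setminus\{(i,j)\})\cup\{(i',j)\},G\cup\{(i,j)\})$. $\mathsf{KKoh}(w)$ is the closure of $(D(w),\varnothing)$ under ordinary and $K$-Kohnert moves. A flagged set-valued Rothe tableau of shape $D(w)$ is a map $T:D(w)\to 2^{[n]}\setminus\{\varnothing\}$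 such that, whenever the relevant cells lie in $D(w)$: (row) $\min T(r,c)\geq\max T(r,c')$ if $c<c'$; (column) $\max T(r,c)<\min T(r',c)$ if $r<r'$; (flag) $\max T(r,c)\leq r$. $\mathrm{SVRT}(w)$ is the set of these; $\mathrm{wt}(T)_i=\#\{(r,c)\in D(w): i\in T(r,c)\}$. For $T\in\mathrm{SVRT}(w)$, $\Theta_w(T)=(B_T,G_T)$ where $B_T=\{(\min T(r,c),c):(r,c)\in D(w)\}$ and $G_T=\{(a,c): \exists (r,c)\in D(w),\ a\in T(r,c),\ a>\min T(r,c)\}$. A column of a grave diagram $E$ is threaded if it is empty or its topmost occupied cell is a box; then its occupied cells, read from north to south, split uniquely into threads, each thread consisting of a box together with all ghosts below it and above the next box of that column (if any). $E$ is thread-compatible with $w$ if every column is threaded and, for each $c$, the number of threads in column $c$ of $E$ equals the number of cells in column $c$ of $D(w)$. For such $E$, assign the threads of each column $c$ from north to south to the cells of $D(w)$ in column $c$ from north to south, and define the filling $\Xi_w(E):D(w)\to 2^{[n]}\setminus\{\varnothing\}$ by letting $\Xi_w(E)(r,c)$ be the set of row indices of the thread assigned to $(r,c)$. -}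

module Defs where

open import Data.Empty using (⊥-elim-irr)
open import Data.Fin.Base using (Fin; zero; suc; _<_; _≤_; cast)
open import Data.Fin.Permutation using (Permutation′; _⟨$⟩ʳ_; _⟨$⟩ˡ_)
open import Data.Fin.Properties
  using (_≟_; _<?_; any?; all?; <-cmp; <-irrefl; <-trans)
open import Data.Fin.Subset using (Subset; Nonempty; Empty; _∈_; inside; outside)
open import Data.Fin.Subset.Properties using (_∈?_; nonempty?)
open import Data.List.Base
  using (List; filter; length; map; lookup; allFin; cartesianProduct)
open import Data.List.Membership.Propositional.Properties using (∈-filter⁺; ∈-allFin)
open import Data.List.Relation.Unary.Any using (index)
open import Data.Nat.Base using (ℕ; z≤n; s≤s)
open import Data.Nat.Properties using (≤-<-trans)
open import Data.Product.Base using (Σ-syntax; ∃-syntax; _×_; _,_; proj₂)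
open import Data.Sum.Base using (_⊎_; inj₁; inj₂)
open import Data.Vec.Base using ([]; _∷_; here; there; tabulate)
open import Data.Vec.Properties using (lookup∘tabulate; lookup⇒[]=)
open import Level using (0ℓ)
open import Relation.Binary.Definitions using (tri<; tri≈; tri>)
open import Relation.Binary.PropositionalEquality
  using (_≡_; refl; sym; trans)
open import Relation.Nullary.Decidable
  using (Dec; does; yes; no; recompute; dec-true; _×-dec_; _⊎-dec_; _→-dec_)
open import Relation.Nullary.Negation using (¬_)
open import Relation.Unary
  using (Pred; Decidable; _∪_; _∖_; ｛_｝; ∅; _≐_; _⊥_)
open import Relation.Unary.Properties using (_∪?_; ∅?)

private variable
  n : ℕ

-- [n] is Fin n, so all indices are shifted down by one.

Cell : ℕ → Set
Cell n = Fin n × Fin n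

count : {A : Set} {P : Pred A 0ℓ} → Decidable P → List A → ℕ
count P? xs = length (filter P? xs)

dec-Σ : {P : Set} {Q : .P → Set} → Dec P → (∀ .p → Dec (Q p)) → Dec (Σ[ p ∈ P ] Q p)
dec-Σ (no ¬p) Q? = no λ (p , _) → ¬p p
dec-Σ (yes p) Q? with Q? p
... | yes q = yes (p , q)
... | no ¬q = no λ (_ , q) → ¬q q

-- The nonemptiness proof is irrelevant, so _≡_ is equality of the
-- underlying subsets.
record NonemptySubset (n : ℕ) : Set where
  constructor mk⁺
  field
    set       : Subset n
    .nonempty : Nonempty set

infix 4 _∈ₛ_
_∈ₛ_ : Fin n → NonemptySubset n → Set
a ∈ₛ S = a ∈ NonemptySubset.set S

empty-[] : Empty []
empty-[] (() , _)

drop-outside : {S : Subset n} → Nonempty (outside ∷ S) → Nonempty S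
drop-outside (suc i , there p) = i , p

least : (S : Subset n) → .(Nonempty S) → Fin n
least []            ne = ⊥-elim-irr (empty-[] ne)
least (inside  ∷ S) ne = zero
least (outside ∷ S) ne = suc (least S (drop-outside ne))

greatest : (S : Subset n) → .(Nonempty S) → Fin n
greatest []      ne = ⊥-elim-irr (empty-[] ne)
greatest (s ∷ S) ne with nonempty? S
... | yes ne′ = suc (greatest S ne′)
... | no  _   = zero

min max : NonemptySubset n → Fin n
min (mk⁺ S ne) = least S ne
max (mk⁺ S ne) = greatest S ne

least-∈ : (S : Subset n) .(ne : Nonempty S) → least S ne ∈ S
least-∈ []            ne = ⊥-elim-irr (empty-[] ne)
least-∈ (inside  ∷ S) ne = here
least-∈ (outside ∷ S) ne = there (least-∈ S (drop-outside ne))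

least-≤ : (S : Subset n) .(ne : Nonempty S) {a : Fin n} → a ∈ S → least S ne ≤ a
least-≤ (inside  ∷ S) ne p         = z≤n
least-≤ (outside ∷ S) ne (there p) = s≤s (least-≤ S (drop-outside ne) p)

greatest-∈ : (S : Subset n) .(ne : Nonempty S) → greatest S ne ∈ S
greatest-∈ []      ne = ⊥-elim-irr (empty-[] ne)
greatest-∈ (s ∷ S) ne with nonempty? S
greatest-∈ (s ∷ S)       ne | yes ne′ = there (greatest-∈ S ne′)
greatest-∈ (inside ∷ S)  ne | no _    = here
greatest-∈ (outside ∷ S) ne | no ¬ne  = ⊥-elim-irr (¬ne (drop-outside ne))

greatest-≥ : (S : Subset n) .(ne : Nonempty S) {a : Fin n} → a ∈ S → a ≤ greatest S ne
greatest-≥ (s ∷ S) ne p with nonempty? S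
greatest-≥ (s ∷ S) ne here      | yes ne′ = z≤n
greatest-≥ (s ∷ S) ne (there p) | yes ne′ = s≤s (greatest-≥ S ne′ p)
greatest-≥ (s ∷ S) ne here      | no _    = z≤n
greatest-≥ (s ∷ S) ne (there p) | no ¬ne  with () ← ¬ne (_ , p)

min-∈ : (S : NonemptySubset n) → min S ∈ₛ S
min-∈ (mk⁺ S ne) = least-∈ S ne

min-≤ : (S : NonemptySubset n) {a : Fin n} → a ∈ₛ S → min S ≤ a
min-≤ (mk⁺ S ne) = least-≤ S ne

max-∈ : (S : NonemptySubset n) → max S ∈ₛ S
max-∈ (mk⁺ S ne) = greatest-∈ S ne

max-≥ : (S : NonemptySubset n) {a : Fin n} → a ∈ₛ S → a ≤ max S
max-≥ (mk⁺ S ne) = greatest-≥ S ne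

-- w ⟨$⟩ʳ i is w(i) and w ⟨$⟩ˡ j is w⁻¹(j).

Avoids1432 : Permutation′ n → Set
Avoids1432 w = ¬ (∃[ j₁ ] ∃[ j₂ ] ∃[ j₃ ] ∃[ j₄ ]
  (j₁ < j₂ × j₂ < j₃ × j₃ < j₄ ×
   w ⟨$⟩ʳ j₁ < w ⟨$⟩ʳ j₄ × w ⟨$⟩ʳ j₄ < w ⟨$⟩ʳ j₃ × w ⟨$⟩ʳ j₃ < w ⟨$⟩ʳ j₂))

Rothe : Permutation′ n → Pred (Cell n) 0ℓ
Rothe w (i , j) = i < w ⟨$⟩ˡ j × j < w ⟨$⟩ʳ i

Rothe? : (w : Permutation′ n) → Decidable (Rothe w)
Rothe? w (i , j) = (i <? w ⟨$⟩ˡ j) ×-dec (j <? w ⟨$⟩ʳ i)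

-- The rows of the cells of D(w) in column c, from north to south.
rotheColumn : Permutation′ n → Fin n → List (Fin n)
rotheColumn {n} w c = filter (λ r → Rothe? w (r , c)) (allFin n)

-- Subsets of the grid are decidable predicates, compared by _≐_.
record GraveDiagram (n : ℕ) : Set₁ where
  field
    Box      : Pred (Cell n) 0ℓ
    Ghost    : Pred (Cell n) 0ℓ
    Box?     : Decidable Box
    Ghost?   : Decidable Ghost
    disjoint : Box ⊥ Ghost

  Occupied : Pred (Cell n) 0ℓ
  Occupied = Box ∪ Ghost

  Occupied? : Decidable Occupied
  Occupied? = Box? ∪? Ghost?

  wt : Fin n → ℕ
  wt i = count (λ j → Occupied? (i , j)) (allFin n)

open GraveDiagram public

infix 4 _≈_
_≈_ : GraveDiagram n → GraveDiagram n → Set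
E ≈ E′ = Box E ≐ Box E′ × Ghost E ≐ Ghost E′

-- The conditions under which a move at row i takes the box (i , j) to row i′.
record Movable (E : GraveDiagram n) (i j i′ : Fin n) : Set where
  field
    box       : Box E (i , j)
    rightmost : ∀ k → Occupied E (i , k) → k ≤ j
    above     : i′ < i
    vacant    : ¬ Occupied E (i′ , j)
    maximal   : ∀ r → r < i → ¬ Occupied E (r , j) → r ≤ i′
    allBoxes  : ∀ r → i′ < r → r ≤ i → Occupied E (r , j) → Box E (r , j)

infix 4 _⟶_
data _⟶_ {n : ℕ} (E E′ : GraveDiagram n) : Set where
  ordinary : ∀ {i j i′} → Movable E i j i′ →
             Box E′ ≐ (Box E ∖ ｛ i , j ｝) ∪ ｛ i′ , j ｝ →
             Ghost E′ ≐ Ghost E →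
             E ⟶ E′
  K-move   : ∀ {i j i′} → Movable E i j i′ →
             Box E′ ≐ (Box E ∖ ｛ i , j ｝) ∪ ｛ i′ , j ｝ →
             Ghost E′ ≐ Ghost E ∪ ｛ i , j ｝ →
             E ⟶ E′

initial : Permutation′ n → GraveDiagram n
initial w = record
  { Box      = Rothe w
  ; Ghost    = ∅
  ; Box?     = Rothe? w
  ; Ghost?   = ∅?
  ; disjoint = proj₂
  }

-- start admits every E ≈ initial w, and _⟶_ fixes its target only up to
-- _≈_, so KKoh w respects equality of grave diagrams.
data KKoh {n : ℕ} (w : Permutation′ n) : GraveDiagram n → Set₁ where
  start : ∀ {E} → E ≈ initial w → KKoh w E
  step  : ∀ {E E′} → KKoh w E → E ⟶ E′ → KKoh w E′

KKohDiagram : Permutation′ n → Set₁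
KKohDiagram {n} w = Σ[ E ∈ GraveDiagram n ] KKoh w E

infix 4 _≈ᴷ_
_≈ᴷ_ : {w : Permutation′ n} → KKohDiagram w → KKohDiagram w → Set
(E , _) ≈ᴷ (E′ , _) = E ≈ E′

-- A map on the cells of D(w); its value at (r , c) does not depend on
-- the proof that (r , c) is in D(w).
Filling : Permutation′ n → Set
Filling {n} w = ∀ r c → .(Rothe w (r , c)) → NonemptySubset n

record IsSVRT {n : ℕ} (w : Permutation′ n) (T : Filling w) : Set where
  field
    row    : ∀ r c c′ (d : Rothe w (r , c)) (d′ : Rothe w (r , c′)) →
             c < c′ → max (T r c′ d′) ≤ min (T r c d)
    column : ∀ r r′ c (d : Rothe w (r , c)) (d′ : Rothe w (r′ , c)) →
             r < r′ → max (T r c d) < min (T r′ c d′)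
    flag   : ∀ r c (d : Rothe w (r , c)) → max (T r c d) ≤ r

SVRT : Permutation′ n → Set
SVRT w = Σ[ T ∈ Filling w ] IsSVRT w T

infix 4 _≈ᵀ_
_≈ᵀ_ : {w : Permutation′ n} → SVRT w → SVRT w → Set
_≈ᵀ_ {w = w} (T , _) (T′ , _) =
  ∀ r c (d : Rothe w (r , c)) → T r c d ≡ T′ r c d

wtᵀ : {w : Permutation′ n} → SVRT w → Fin n → ℕ
wtᵀ {n} {w} (T , _) i = count i∈T? (cartesianProduct (allFin n) (allFin n))
  where
  i∈T? : Decidable (λ ((r , c) : Cell n) → Σ[ d ∈ Rothe w (r , c) ] i ∈ₛ T r c d)
  i∈T? (r , c) = dec-Σ (Rothe? w (r , c)) (λ d → i ∈? NonemptySubset.set (T r c d))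

Θ : (w : Permutation′ n) → SVRT w → GraveDiagram n
Θ {n} w (T , isSVRT) = record
  { Box      = B
  ; Ghost    = G
  ; Box?     = λ (a , c) → any? λ r →
                 dec-Σ (Rothe? w (r , c)) (λ d → a ≟ min (T r c d))
  ; Ghost?   = λ (a , c) → any? λ r →
                 dec-Σ (Rothe? w (r , c)) (λ d →
                   (a ∈? NonemptySubset.set (T r c d)) ×-dec (min (T r c d) <? a))
  ; disjoint = B⊥G
  }
  where
  open IsSVRT isSVRT

  B G : Pred (Cell n) 0ℓ
  B (a , c) = ∃[ r ] Σ[ d ∈ Rothe w (r , c) ] a ≡ min (T r c d)
  G (a , c) = ∃[ r ] Σ[ d ∈ Rothe w (r , c) ] (a ∈ₛ T r c d × min (T r c d) < a)

  B⊥G : B ⊥ G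
  B⊥G {a , c} ((r , d , refl) , (r′ , d′ , a∈T′ , min<a)) with <-cmp r r′
  ... | tri< r<r′ _ _ = <-irrefl refl
          (<-trans (≤-<-trans (max-≥ (T r c d) (min-∈ (T r c d))) (column r r′ c d d′ r<r′))
                   min<a)
  ... | tri≈ _ refl _ = <-irrefl refl min<a
  ... | tri> _ _ r′<r = <-irrefl refl
          (≤-<-trans (max-≥ (T r′ c d′) a∈T′) (column r′ r c d′ d r′<r))

Threaded : GraveDiagram n → Fin n → Set
Threaded E c =
  (∀ a → ¬ Occupied E (a , c)) ⊎
  (∃[ a ] (Box E (a , c) × (∀ b → Occupied E (b , c) → a ≤ b)))

-- For a box (b , c): the rows of that box and of the ghosts below it and
-- above every box of column c that is below (b , c).
InThread : GraveDiagram n → Fin n → Fin n → Pred (Fin n) 0ℓ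
InThread E c b a =
  a ≡ b ⊎
  (Ghost E (a , c) × b < a × (∀ b′ → Box E (b′ , c) → b < b′ → a < b′))

InThread? : (E : GraveDiagram n) (c b : Fin n) → Decidable (InThread E c b)
InThread? E c b a =
  (a ≟ b) ⊎-dec
  (Ghost? E (a , c) ×-dec ((b <? a) ×-dec
    all? (λ b′ → Box? E (b′ , c) →-dec ((b <? b′) →-dec (a <? b′)))))

thread : GraveDiagram n → Fin n → Fin n → NonemptySubset n
thread E c b = mk⁺ (tabulate (λ a → does (InThread? E c b a))) (b , b∈)
  where
  b∈ : b ∈ tabulate (λ a → does (InThread? E c b a))
  b∈ = lookup⇒[]= b _
         (trans (lookup∘tabulate _ b) (dec-true (InThread? E c b b) (inj₁ refl)))

-- The threads of column c, from north to south: one for each box.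
threads : GraveDiagram n → Fin n → List (NonemptySubset n)
threads {n} E c = map (thread E c) (filter (λ b → Box? E (b , c)) (allFin n))

record ThreadCompatible {n : ℕ} (w : Permutation′ n) (E : GraveDiagram n) : Set where
  field
    threaded : ∀ c → Threaded E c
    numbers  : ∀ c → length (threads E c) ≡ length (rotheColumn w c)

-- allFin is increasing, so this counts from north to south, like threads.
position : (w : Permutation′ n) → ∀ r c → .(Rothe w (r , c)) →
           Fin (length (rotheColumn w c))
position w r c d =
  index (∈-filter⁺ (λ r → Rothe? w (r , c)) (∈-allFin r) (recompute (Rothe? w (r , c)) d))

Ξ : (w : Permutation′ n) (E : GraveDiagram n) → .(ThreadCompatible w E) → Filling w
Ξ w E compatible r c d =
  lookup (threads E c)
         (cast (sym (ThreadCompatible.numbers compatible c)) (position w r c d))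

{-# OPTIONS --safe #-}
module Submission where

-- A diagram Θ(T) determines T, since column strictness stacks the sets of a column.
--
-- A move on Θ(T) slides a run of consecutive boxes of one column up by one row, and doing
-- the same to T could only violate the row condition, when an entry b that slides also occurs
-- to the right of it in its own row r of T.  Since b is free to slide, some w(a) with a < r is
-- smaller than the column index, and then avoiding 1432 puts the cells of D(w) to the right in
-- row r also into the lower rows of the run.  So b, …, i would be repeated in that other column,
-- contradicting that the moved box is rightmost.  Hence KKoh(w) consists of diagrams Θ(T).
--
-- Conversely, in the lowest row R with T(R, c) ≠ {R} for some c, take the leftmost such c and
-- replace m = min T(R, c) by m + 1.  The result is in SVRT(w), and one move on its diagram
-- gives Θ(T): an entry m + 1 in a higher row r and a column to the right would force (r, c)
-- into D(w), with no room for its entries.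


open import Defs
open import Data.Fin.Base as Fin using (Fin; zero; suc; toℕ; fromℕ<; cast)
open import Data.Fin.Permutation using (Permutation′; _⟨$⟩ʳ_; _⟨$⟩ˡ_; inverseʳ; inverseˡ)
open import Data.Fin.Properties as Finₚ
  using (_≟_; toℕ-injective; toℕ-fromℕ<; toℕ<n; any?; ≤-totalOrder)
open import Data.Fin.Subset using (Subset; Nonempty; _∈_)
open import Data.Fin.Subset.Properties using (_∈?_; ⊆-antisym; nonempty?)
open import Data.List.Base
  using (List; []; _∷_; allFin; filter; map; length; lookup; cartesianProduct)
import Data.List.Membership.Propositional as List
open import Data.List.Membership.Propositional.Properties
  using (∈-filter⁺; ∈-filter⁻; ∈-map⁺; ∈-map⁻; ∈-allFin; ∈-cartesianProduct⁺)
open import Data.List.Membership.Propositional.Properties.WithK using (unique∧set⇒bag)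
open import Data.List.Properties using (length-map; map-∘)
open import Data.List.Relation.Binary.BagAndSetEquality using (∼bag⇒↭)
open import Data.List.Relation.Binary.Permutation.Propositional using (_↭_; ↭⇒↭ₛ)
open import Data.List.Relation.Binary.Permutation.Propositional.Properties using (↭-length)
open import Data.List.Relation.Binary.Pointwise using (Pointwise-≡⇒≡)
open import Data.List.Relation.Unary.All as All using (All; []; _∷_)
open import Data.List.Relation.Unary.All.Properties using (all-filter)
open import Data.List.Relation.Unary.AllPairs as AllPairs using (AllPairs; []; _∷_)
import Data.List.Relation.Unary.AllPairs.Properties as AllPairs
open import Data.List.Relation.Unary.Any.Properties using (lookup-index)
open import Data.List.Relation.Unary.Sorted.TotalOrder using (Sorted)
open import Data.List.Relation.Unary.Sorted.TotalOrder.Properties using (↗↭↗⇒≋; AllPairs⇒Sorted)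
open import Data.List.Relation.Unary.Unique.Propositional using (Unique)
import Data.List.Relation.Unary.Unique.Propositional.Properties as Unique
open import Data.Nat.Base using (ℕ; zero; suc; _+_; _<_; _≤_; z≤n; s≤s; s≤s⁻¹)
open import Data.Nat.Properties
  using ( ≤-refl; ≤-reflexive; ≤-trans; ≤-antisym; <-trans; <-irrefl; <⇒≤; <⇒≱; ≮⇒≥; ≰⇒>
        ; ≤-<-trans; <-≤-trans; ≤∧≢⇒<; m≤n⇒m<n∨m≡n; n<1+n; n≤1+n; m≤m+n; m<m+n
        ; m≤n+m; +-monoˡ-≤; m+[n∸m]≡n; +-identityʳ; +-suc; suc-injective )
import Data.Nat.Properties as ℕ
open import Data.Product.Base using (Σ-syntax; ∃-syntax; _×_; _,_; proj₁; proj₂)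
open import Data.Sum.Base using (_⊎_; inj₁; inj₂; map₁)
open import Data.Vec.Base using (tabulate)
open import Data.Vec.Properties using (lookup∘tabulate; lookup⇒[]=; []=⇒lookup)
open import Function.Base using (_∘_)
open import Function.Bundles using (mk⇔)
open import Function.Structures using (IsInverse)
open import Level using (0ℓ)
open import Relation.Binary.Definitions using (tri<; tri≈; tri>)
open import Relation.Binary.PropositionalEquality
  using (_≡_; _≢_; refl; sym; trans; cong; subst; subst₂; module ≡-Reasoning)
open import Relation.Nullary.Decidable
  using (Dec; does; yes; no; recompute; dec-true; _×-dec_; _⊎-dec_; ¬?)
open import Relation.Nullary.Negation using (¬_; contradiction)
open import Relation.Unary using (Pred; Decidable; _⊆_; _≐_; _∪_; _∖_; ｛_｝)
open import Relation.Unary.Properties using (≐-sym; ≐-trans)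

private variable
  n : ℕ

-- Subsets, increasing lists and neighbours in `Fin n`.

∈-tabulate⁺ : {P : Pred (Fin n) 0ℓ} (P? : Decidable P) {a : Fin n} →
              P a → a ∈ tabulate (λ b → does (P? b))
∈-tabulate⁺ P? {a} p = lookup⇒[]= a _ (trans (lookup∘tabulate _ a) (dec-true (P? a) p))

∈-tabulate⁻ : {P : Pred (Fin n) 0ℓ} (P? : Decidable P) {a : Fin n} →
              a ∈ tabulate (λ b → does (P? b)) → P a
∈-tabulate⁻ P? {a} a∈
  with P? a | trans (sym (lookup∘tabulate (λ b → does (P? b)) a)) ([]=⇒lookup a∈)
... | yes p | _ = p

extensionality : {S S′ : NonemptySubset n} →
                 (∀ {a} → a ∈ₛ S → a ∈ₛ S′) → (∀ {a} → a ∈ₛ S′ → a ∈ₛ S) → S ≡ S′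
extensionality {S = mk⁺ S _} {mk⁺ S′ _} S⊆S′ S′⊆S
  with refl ← ⊆-antisym {i = S} {S′} S⊆S′ S′⊆S = refl

unique-↭ : {A : Set} {xs ys : List A} → Unique xs → Unique ys →
           (∀ {x} → x List.∈ xs → x List.∈ ys) → (∀ {x} → x List.∈ ys → x List.∈ xs) → xs ↭ ys
unique-↭ xs! ys! xs⊆ys ys⊆xs = ∼bag⇒↭ (unique∧set⇒bag xs! ys! (mk⇔ xs⊆ys ys⊆xs))

increasing⇒unique : {xs : List (Fin n)} → AllPairs Fin._<_ xs → Unique xs
increasing⇒unique = AllPairs.map Finₚ.<⇒≢

-- Both lists are sorted and, having no repetitions and the same elements, permutations of each
-- other. This matches the boxes of a column with the minima of its cells.
increasing-≡ : {xs ys : List (Fin n)} → AllPairs Fin._<_ xs → AllPairs Fin._<_ ys →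
               (∀ {x} → x List.∈ xs → x List.∈ ys) → (∀ {x} → x List.∈ ys → x List.∈ xs) → xs ≡ ys
increasing-≡ {n} xs↗ ys↗ xs⊆ys ys⊆xs = Pointwise-≡⇒≡
  (↗↭↗⇒≋ (≤-totalOrder n) (sorted xs↗) (sorted ys↗)
    (↭⇒↭ₛ (unique-↭ (increasing⇒unique xs↗) (increasing⇒unique ys↗) xs⊆ys ys⊆xs)))
  where
  sorted : ∀ {zs} → AllPairs Fin._<_ zs → Sorted (≤-totalOrder n) zs
  sorted zs↗ = AllPairs⇒Sorted (≤-totalOrder n) (AllPairs.map <⇒≤ zs↗)

allFin-increasing : ∀ n → AllPairs Fin._<_ (allFin n)
allFin-increasing n = AllPairs.tabulate⁺-< (λ i<j → i<j)

All×AllPairs : {A : Set} {P : Pred A 0ℓ} {R : A → A → Set} {xs : List A} →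
               All P xs → AllPairs R xs → AllPairs (λ x y → P x × P y × R x y) xs
All×AllPairs []         []         = []
All×AllPairs (px ∷ pxs) (rx ∷ rxs) =
  All.zipWith (λ (py , rxy) → px , py , rxy) (pxs , rx) ∷ All×AllPairs pxs rxs

lookup-map-cast : {A B : Set} (f : A → B) (xs : List A) {ys : List B} (eq : ys ≡ map f xs)
                  .(len : length xs ≡ length ys) (i : Fin (length xs)) →
                  lookup ys (cast len i) ≡ f (lookup xs i)
lookup-map-cast f (x ∷ xs) refl len zero    = refl
lookup-map-cast f (x ∷ xs) refl len (suc i) = lookup-map-cast f xs refl (suc-injective len) i

pred-Fin : {b : Fin n} → 0 < toℕ b → Σ[ a ∈ Fin n ] toℕ b ≡ suc (toℕ a)
pred-Fin {suc n} {suc b} _ = Fin.inject₁ b , cong suc (sym (Finₚ.toℕ-inject₁ b))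

suc-Fin : {a i : Fin n} → a Fin.< i → Σ[ b ∈ Fin n ] toℕ b ≡ suc (toℕ a)
suc-Fin {i = i} a<i = fromℕ< (≤-<-trans a<i (toℕ<n i)) , toℕ-fromℕ< _

-- Tableau conditions in terms of entries.

module _ {n : ℕ} (w : Permutation′ n) where

  Mem : Filling w → Fin n → Fin n → Pred (Fin n) 0ℓ
  Mem T r c a = Σ[ d ∈ Rothe w (r , c) ] a ∈ₛ T r c d

  IsMin : Filling w → Fin n → Fin n → Pred (Fin n) 0ℓ
  IsMin T r c a = Mem T r c a × (∀ b → Mem T r c b → a Fin.≤ b)

  -- For nonempty sets, comparing maximum with minimum means comparing all pairs of entries. This
  -- form suits fillings that are given by a predicate on entries.
  record Semistandard (T : Filling w) : Set where
    field
      row    : ∀ {r c c′ a b} → c Fin.< c′ → Mem T r c′ a → Mem T r c b → a Fin.≤ b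
      column : ∀ {r r′ c a b} → r Fin.< r′ → Mem T r c a → Mem T r′ c b → a Fin.< b
      flag   : ∀ {r c a} → Mem T r c a → a Fin.≤ r

    -- Column strictness makes the sets of a column disjoint, so an occupied cell of the diagram
    -- comes from a single cell of the tableau.
    owner-unique : ∀ {r r′ c a} → Mem T r c a → Mem T r′ c a → r ≡ r′
    owner-unique {r} {r′} p q with Finₚ.<-cmp r r′
    ... | tri< r<r′ _ _ = contradiction (column r<r′ p q) (<-irrefl refl)
    ... | tri≈ _ r≡r′ _ = r≡r′
    ... | tri> _ _ r′<r = contradiction (column r′<r q p) (<-irrefl refl)

    owner-mono : ∀ {r r′ c a b} → Mem T r c a → Mem T r′ c b → a Fin.< b → r Fin.≤ r′
    owner-mono p q a<b = ≮⇒≥ λ r′<r → <⇒≱ a<b (<⇒≤ (column r′<r q p))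

  IsSVRT⇒Semistandard : ∀ {T} → IsSVRT w T → Semistandard T
  IsSVRT⇒Semistandard {T} isSVRT = record
    { row    = λ {r} {c} {c′} c<c′ (d′ , a∈) (d , b∈) →
        ≤-trans (max-≥ (T r c′ d′) a∈) (≤-trans (S.row r c c′ d d′ c<c′) (min-≤ (T r c d) b∈))
    ; column = λ {r} {r′} {c} r<r′ (d , a∈) (d′ , b∈) →
        ≤-<-trans (max-≥ (T r c d) a∈)
          (<-≤-trans (S.column r r′ c d d′ r<r′) (min-≤ (T r′ c d′) b∈))
    ; flag   = λ {r} {c} (d , a∈) → ≤-trans (max-≥ (T r c d) a∈) (S.flag r c d)
    }
    where module S = IsSVRT isSVRT

  Semistandard⇒IsSVRT : ∀ {T} → Semistandard T → IsSVRT w T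
  Semistandard⇒IsSVRT {T} T-ss = record
    { row    = λ r c c′ d d′ c<c′ → row c<c′ (d′ , max-∈ (T r c′ d′)) (d , min-∈ (T r c d))
    ; column = λ r r′ c d d′ r<r′ → column r<r′ (d , max-∈ (T r c d)) (d′ , min-∈ (T r′ c d′))
    ; flag   = λ r c d → flag (d , max-∈ (T r c d))
    }
    where open Semistandard T-ss

  min-IsMin : ∀ T {r c} (d : Rothe w (r , c)) → IsMin T r c (min (T r c d))
  min-IsMin T {r} {c} d = (d , min-∈ (T r c d)) , λ b (_ , b∈) → min-≤ (T r c d) b∈

  IsMin⇒≡min : ∀ T {r c a} (d : Rothe w (r , c)) → IsMin T r c a → a ≡ min (T r c d)
  IsMin⇒≡min T {r} {c} d ((_ , a∈) , a≤) =
    toℕ-injective (≤-antisym (a≤ _ (d , min-∈ (T r c d))) (min-≤ (T r c d) a∈))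

  Box-Θ⁺ : ∀ {T : SVRT w} {r c a} → IsMin (proj₁ T) r c a → Box (Θ w T) (a , c)
  Box-Θ⁺ {T , _} {r} a-min@((d , _) , _) = r , d , IsMin⇒≡min T d a-min

  Box-Θ⁻ : ∀ {T : SVRT w} {c a} → Box (Θ w T) (a , c) → ∃[ r ] IsMin (proj₁ T) r c a
  Box-Θ⁻ {T , _} (r , d , refl) = r , min-IsMin T d

  Occupied-Θ⁺ : ∀ {T : SVRT w} {r c a} → Mem (proj₁ T) r c a → Occupied (Θ w T) (a , c)
  Occupied-Θ⁺ {T , _} {r} {c} {a} (d , a∈) with min (T r c d) ≟ a
  ... | yes refl = inj₁ (r , d , refl)
  ... | no min≢a = inj₂ (r , d , a∈ , ≤∧≢⇒< (min-≤ (T r c d) a∈) (min≢a ∘ toℕ-injective))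

  Occupied-Θ⁻ : ∀ {T : SVRT w} {c a} → Occupied (Θ w T) (a , c) → ∃[ r ] Mem (proj₁ T) r c a
  Occupied-Θ⁻ {T , _} {c} (inj₁ (r , d , refl)) = r , d , min-∈ (T r c d)
  Occupied-Θ⁻ (inj₂ (r , d , a∈ , _))   = r , d , a∈

  fromPred : (Q : Fin n → Fin n → Pred (Fin n) 0ℓ) → (∀ r c → Decidable (Q r c)) →
             .(∀ r c → Rothe w (r , c) → ∃[ a ] Q r c a) → Filling w
  fromPred Q Q? inh r c d = mk⁺ (tabulate (λ a → does (Q? r c a))) (nonempty (inh r c d))
    where
    nonempty : ∃[ a ] Q r c a → Nonempty (tabulate (λ a → does (Q? r c a)))
    nonempty (a , q) = a , ∈-tabulate⁺ (Q? r c) q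

-- Invariance of moves under equality of diagrams.

≈-refl : {E : GraveDiagram n} → E ≈ E
≈-refl = ((λ x → x) , (λ x → x)) , ((λ x → x) , (λ x → x))

≈-sym : {E F : GraveDiagram n} → E ≈ F → F ≈ E
≈-sym (b , g) = ≐-sym b , ≐-sym g

≈-trans : {E F G : GraveDiagram n} → E ≈ F → F ≈ G → E ≈ G
≈-trans (b , g) (b′ , g′) = ≐-trans b b′ , ≐-trans g g′

Occupied-cong : {E F : GraveDiagram n} → E ≈ F → Occupied E ≐ Occupied F
Occupied-cong ((b , b′) , (g , g′)) =
  (λ { (inj₁ x) → inj₁ (b x) ; (inj₂ x) → inj₂ (g x) }) ,
  (λ { (inj₁ x) → inj₁ (b′ x) ; (inj₂ x) → inj₂ (g′ x) })

Movable-cong : {E F : GraveDiagram n} → E ≈ F → ∀ {i j i′} → Movable E i j i′ → Movable F i j i′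
Movable-cong {E = E} {F} E≈F mv = record
  { box       = proj₁ (proj₁ E≈F) box
  ; rightmost = λ k o → rightmost k (F⇒E o)
  ; above     = above
  ; vacant    = λ o → vacant (F⇒E o)
  ; maximal   = λ r r<i ¬o → maximal r r<i (λ o → ¬o (E⇒F o))
  ; allBoxes  = λ r i′<r r≤i o → proj₁ (proj₁ E≈F) (allBoxes r i′<r r≤i (F⇒E o))
  }
  where
  open Movable mv
  E⇒F : Occupied E ⊆ Occupied F
  E⇒F = proj₁ (Occupied-cong {E = E} {F} E≈F)
  F⇒E : Occupied F ⊆ Occupied E
  F⇒E = proj₂ (Occupied-cong {E = E} {F} E≈F)

∪-congˡ : {A : Set} {P P′ Q : Pred A 0ℓ} → P ≐ P′ → P ∪ Q ≐ P′ ∪ Q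
∪-congˡ (P⊆P′ , P′⊆P) = map₁ P⊆P′ , map₁ P′⊆P

∖-congˡ : {A : Set} {P P′ Q : Pred A 0ℓ} → P ≐ P′ → P ∖ Q ≐ P′ ∖ Q
∖-congˡ (P⊆P′ , P′⊆P) = (λ (p , ¬q) → P⊆P′ p , ¬q) , (λ (p , ¬q) → P′⊆P p , ¬q)

-- The target of a move is given only by equations for its boxes and ghosts, so a change of source
-- is absorbed by composing equations.
⟶-congˡ : {E F E′ : GraveDiagram n} → E ≈ F → E ⟶ E′ → F ⟶ E′
⟶-congˡ E≈F@(b , g) (ordinary mv box ghost) =
  ordinary (Movable-cong E≈F mv) (≐-trans box (∪-congˡ (∖-congˡ b))) (≐-trans ghost g)
⟶-congˡ E≈F@(b , g) (K-move mv box ghost) =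
  K-move (Movable-cong E≈F mv) (≐-trans box (∪-congˡ (∖-congˡ b))) (≐-trans ghost (∪-congˡ g))

-- Recovering a tableau from the threads of its diagram.

module _ {n : ℕ} (w : Permutation′ n) (T* : SVRT w) {E : GraveDiagram n} (E≈ΘT : E ≈ Θ w T*) where

  private
    T = proj₁ T*
    open Semistandard (IsSVRT⇒Semistandard w (proj₂ T*))

    Box⁺ : ∀ {r c a} → IsMin w T r c a → Box E (a , c)
    Box⁺ m = proj₂ (proj₁ E≈ΘT) (Box-Θ⁺ w {T*} m)

    Box⁻ : ∀ {c a} → Box E (a , c) → ∃[ r ] IsMin w T r c a
    Box⁻ b = Box-Θ⁻ w {T*} (proj₁ (proj₁ E≈ΘT) b)

    Occ⁺ : ∀ {r c a} → Mem w T r c a → Occupied E (a , c)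
    Occ⁺ m = proj₂ (Occupied-cong {E = E} {Θ w T*} E≈ΘT) (Occupied-Θ⁺ w {T*} m)

    Occ⁻ : ∀ {c a} → Occupied E (a , c) → ∃[ r ] Mem w T r c a
    Occ⁻ o = Occupied-Θ⁻ w {T*} (proj₁ (Occupied-cong {E = E} {Θ w T*} E≈ΘT) o)

  -- Junk value r when (r , c) is not in D(w).
  boxRow : Fin n → Fin n → Fin n
  boxRow c r with Rothe? w (r , c)
  ... | yes d = min (T r c d)
  ... | no  _ = r

  boxRow-≡ : ∀ {r c} (d : Rothe w (r , c)) → boxRow c r ≡ min (T r c d)
  boxRow-≡ {r} {c} d with Rothe? w (r , c)
  ... | yes _ = refl
  ... | no ¬d = contradiction d ¬d

  -- Minima strictly increase down a column, so the boxes from north to south come in the order of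
  -- the cells of D(w).
  boxes-≡ : ∀ c → filter (λ b → Box? E (b , c)) (allFin n) ≡ map (boxRow c) (rotheColumn w c)
  boxes-≡ c = increasing-≡
    (AllPairs.filter⁺ _ (allFin-increasing n))
    (AllPairs.map⁺ (AllPairs.map boxRow-mono
      (All×AllPairs (all-filter (λ r → Rothe? w (r , c)) (allFin n))
                    (AllPairs.filter⁺ _ (allFin-increasing n)))))
    to from
    where
    boxRow-mono : ∀ {r r′} → Rothe w (r , c) × Rothe w (r′ , c) × r Fin.< r′ →
                  boxRow c r Fin.< boxRow c r′
    boxRow-mono {r} {r′} (d , d′ , r<r′) rewrite boxRow-≡ d | boxRow-≡ d′ =
      column r<r′ (proj₁ (min-IsMin w T d)) (proj₁ (min-IsMin w T d′))
    to : ∀ {b} → b List.∈ filter (λ b → Box? E (b , c)) (allFin n) →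
         b List.∈ map (boxRow c) (rotheColumn w c)
    to {b} b∈
      with r , b-min@((d , _) , _) ←
        Box⁻ (proj₂ (∈-filter⁻ (λ b → Box? E (b , c)) {xs = allFin n} b∈)) =
      subst (List._∈ map (boxRow c) (rotheColumn w c))
        (trans (boxRow-≡ d) (sym (IsMin⇒≡min w T d b-min)))
        (∈-map⁺ (boxRow c) (∈-filter⁺ (λ r → Rothe? w (r , c)) (∈-allFin r) d))
    from : ∀ {b} → b List.∈ map (boxRow c) (rotheColumn w c) →
           b List.∈ filter (λ b → Box? E (b , c)) (allFin n)
    from b∈ with r , r∈ , refl ← ∈-map⁻ (boxRow c) b∈
            with d ← proj₂ (∈-filter⁻ (λ r → Rothe? w (r , c)) {xs = allFin n} r∈) =
      ∈-filter⁺ _ (∈-allFin _)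
        (subst (λ b → Box E (b , c)) (sym (boxRow-≡ d)) (Box⁺ (min-IsMin w T d)))

  threads-≡ : ∀ c → threads E c ≡ map (thread E c ∘ boxRow c) (rotheColumn w c)
  threads-≡ c = trans (cong (map (thread E c)) (boxes-≡ c)) (sym (map-∘ (rotheColumn w c)))

  -- By column strictness the entries of a cell other than its minimum are ghosts above the next
  -- box, and ghosts of other cells lie above this box or below a later one.
  thread-min : ∀ {r c} (d : Rothe w (r , c)) → thread E c (min (T r c d)) ≡ T r c d
  thread-min {r} {c} d = extensionality to from
    where
    m = min (T r c d)
    m-min = min-IsMin w T d
    to : ∀ {a} → a ∈ₛ thread E c m → a ∈ₛ T r c d
    to {a} a∈ with ∈-tabulate⁻ (InThread? E c m) a∈
    ... | inj₁ refl = min-∈ (T r c d)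
    ... | inj₂ (g , m<a , above) with proj₁ (proj₂ E≈ΘT) g
    ...   | r′ , d′ , a∈′ , m′<a with Finₚ.<-cmp r r′
    ...     | tri≈ _ refl _ = a∈′
    -- The minimum of the lower cell is a box below `m`, so the thread ends above it, while `a` lies
    -- below it.
    ...     | tri< r<r′ _ _ = contradiction
                (above _ (Box⁺ (min-IsMin w T d′))
                  (column r<r′ (proj₁ m-min) (d′ , min-∈ (T r′ c d′))))
                (<⇒≱ m′<a ∘ <⇒≤)
    ...     | tri> _ _ r′<r = contradiction (column r′<r (d′ , a∈′) (proj₁ m-min)) (<⇒≱ m<a ∘ <⇒≤)
    from : ∀ {a} → a ∈ₛ T r c d → a ∈ₛ thread E c m
    from {a} a∈ = ∈-tabulate⁺ (InThread? E c m) inThread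
      where
      inThread : InThread E c m a
      inThread with a ≟ m
      ... | yes a≡m = inj₁ a≡m
      ... | no a≢m = inj₂ (proj₂ (proj₂ E≈ΘT) (r , d , a∈ , m<a) , m<a , above)
        where
        m<a : m Fin.< a
        m<a = ≤∧≢⇒< (min-≤ (T r c d) a∈) (a≢m ∘ sym ∘ toℕ-injective)
        above : ∀ b → Box E (b , c) → m Fin.< b → a Fin.< b
        above b box m<b with Box⁻ box
        ... | r′ , b-min with m≤n⇒m<n∨m≡n (owner-mono (proj₁ m-min) (proj₁ b-min) m<b)
        ...   | inj₁ r<r′ = column r<r′ (d , a∈) (proj₁ b-min)
        ...   | inj₂ r≡r′ with refl ← toℕ-injective r≡r′ =
                  contradiction (proj₂ b-min m (proj₁ m-min)) (<⇒≱ m<b)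

  compatible : ThreadCompatible w E
  compatible = record
    { threaded = λ c → threaded c (nonempty? (occupiedRows c))
    ; numbers  = λ c → trans (cong length (threads-≡ c)) (length-map _ (rotheColumn w c))
    }
    where
    occupiedRows : Fin n → Subset n
    occupiedRows c = tabulate (λ a → does (Occupied? E (a , c)))
    threaded : ∀ c → Dec (Nonempty (occupiedRows c)) → Threaded E c
    threaded c (no empty) = inj₁ λ a occ → empty (a , ∈-tabulate⁺ (λ a → Occupied? E (a , c)) occ)
    threaded c (yes ne)   =
      -- `top` is at most every entry of the cell that contains it, hence the minimum of that cell
      -- and a box.
      inj₂ (top , Box⁺ (proj₂ (Occ⁻ top-occ) , λ b q → topmost b (Occ⁺ q)) , topmost)
      where
      top = least (occupiedRows c) ne
      top-occ : Occupied E (top , c)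
      top-occ = ∈-tabulate⁻ (λ a → Occupied? E (a , c)) (least-∈ (occupiedRows c) ne)
      topmost : ∀ b → Occupied E (b , c) → top Fin.≤ b
      topmost b occ = least-≤ (occupiedRows c) ne (∈-tabulate⁺ (λ a → Occupied? E (a , c)) occ)

  Ξ-≡ : .(E-compatible : ThreadCompatible w E) →
        ∀ r c (d : Rothe w (r , c)) → Ξ w E E-compatible r c d ≡ T r c d
  Ξ-≡ E-compatible r c d = begin
    Ξ w E E-compatible r c d
      ≡⟨ lookup-map-cast (thread E c ∘ boxRow c) (rotheColumn w c) (threads-≡ c)
           (sym (ThreadCompatible.numbers E-compatible c)) (position w r c d) ⟩
    thread E c (boxRow c (lookup (rotheColumn w c) (position w r c d)))
      ≡⟨ cong (thread E c ∘ boxRow c) (lookup-index (∈-filter⁺ (λ r → Rothe? w (r , c)) (∈-allFin r)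
                                      (recompute (Rothe? w (r , c)) d))) ⟨
    thread E c (boxRow c r)
      ≡⟨ cong (thread E c) (boxRow-≡ d) ⟩
    thread E c (min (T r c d))
      ≡⟨ thread-min d ⟩
    T r c d ∎
    where open ≡-Reasoning

-- Preservation of weight.

module _ {n : ℕ} {P : Pred (Cell n) 0ℓ} (P? : Decidable P)
         {Q : Pred (Fin n) 0ℓ} (Q? : Decidable Q) where

  -- With at most one cell of `P` per column, projection to the column is injective on `P`, and its
  -- image is `Q`.
  count-columns : (∀ {r c} → P (r , c) → Q c) → (∀ {c} → Q c → ∃[ r ] P (r , c)) →
                  (∀ {r r′ c} → P (r , c) → P (r′ , c) → r ≡ r′) →
                  count Q? (allFin n) ≡ count P? (cartesianProduct (allFin n) (allFin n))
  count-columns P⇒Q Q⇒P P-unique = trans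
    (↭-length (unique-↭ (Unique.filter⁺ Q? (Unique.allFin⁺ n)) columns-unique to from))
    (length-map proj₂ cells)
    where
    grid = cartesianProduct (allFin n) (allFin n)
    cells = filter P? grid
    columns-unique : Unique (map proj₂ cells)
    columns-unique = AllPairs.map⁺ (AllPairs.map
      (λ { (p , p′ , x≢y) refl → x≢y (cong (_, _) (P-unique p p′)) })
      (All×AllPairs (all-filter P? grid)
        (Unique.filter⁺ P? (Unique.cartesianProduct⁺ (Unique.allFin⁺ n) (Unique.allFin⁺ n)))))
    to : ∀ {c} → c List.∈ filter Q? (allFin n) → c List.∈ map proj₂ cells
    to c∈ with r , p ← Q⇒P (proj₂ (∈-filter⁻ Q? {xs = allFin n} c∈)) =
      ∈-map⁺ proj₂ (∈-filter⁺ P? (∈-cartesianProduct⁺ (∈-allFin r) (∈-allFin _)) p)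
    from : ∀ {c} → c List.∈ map proj₂ cells → c List.∈ filter Q? (allFin n)
    from c∈ with (r , c) , x∈ , refl ← ∈-map⁻ proj₂ c∈ =
      ∈-filter⁺ Q? (∈-allFin c) (P⇒Q (proj₂ (∈-filter⁻ P? {xs = grid} x∈)))

module _ {n : ℕ} (w : Permutation′ n) where

  Θ-weight : ∀ T i → wt (Θ w T) i ≡ wtᵀ T i
  Θ-weight T* i = count-columns _ (λ j → Occupied? (Θ w T*) (i , j))
    (Occupied-Θ⁺ w {T*}) (Occupied-Θ⁻ w {T*}) (owner-unique)
    where open Semistandard (IsSVRT⇒Semistandard w (proj₂ T*))

  -- Rothe diagrams and avoidance of 1432.

  -- If (x, c′) were outside D(w), then y = w⁻¹(c′) or y = x would satisfy r < y < w⁻¹(c) and c <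
  -- w(y) < w(r), and the positions a, r, y, w⁻¹(c) would carry the pattern 1432.
  1432-Rothe : Avoids1432 w → ∀ {a r x c c′} →
               a Fin.< r → w ⟨$⟩ʳ a Fin.< c → r Fin.< x → c Fin.< c′ →
               Rothe w (x , c) → Rothe w (r , c′) → Rothe w (x , c′)
  1432-Rothe avoids {a} {r} {x} {c} {c′} a<r wa<c r<x c<c′ (x<w⁻¹c , c<wx) (r<w⁻¹c′ , c′<wr) =
    x<w⁻¹c′ , c′<wx
    where
    no-pattern : ∀ y → r Fin.< y → y Fin.< w ⟨$⟩ˡ c → c Fin.< w ⟨$⟩ʳ y → ¬ w ⟨$⟩ʳ y Fin.< w ⟨$⟩ʳ r
    no-pattern y r<y y<w⁻¹c c<wy wy<wr = avoids
      ( a , r , y , w ⟨$⟩ˡ c , a<r , r<y , y<w⁻¹c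
      , subst (w ⟨$⟩ʳ a Fin.<_) (sym (inverseʳ w)) wa<c
      , subst (Fin._< w ⟨$⟩ʳ y) (sym (inverseʳ w)) c<wy
      , wy<wr )
    x<w⁻¹c′ : x Fin.< w ⟨$⟩ˡ c′
    x<w⁻¹c′ = ≰⇒> λ w⁻¹c′≤x → no-pattern (w ⟨$⟩ˡ c′) r<w⁻¹c′ (≤-<-trans w⁻¹c′≤x x<w⁻¹c)
      (subst (c Fin.<_) (sym (inverseʳ w)) c<c′)
      (subst (Fin._< w ⟨$⟩ʳ r) (sym (inverseʳ w)) c′<wr)
    c′<wx : c′ Fin.< w ⟨$⟩ʳ x
    c′<wx = ≰⇒> λ wx≤c′ → no-pattern x r<x x<w⁻¹c c<wx (≤-<-trans wx≤c′ c′<wr)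

  Rothe-northwest : ∀ {r r′ c c′} → r Fin.< r′ → c Fin.< c′ →
                    Rothe w (r , c′) → Rothe w (r′ , c) → Rothe w (r , c)
  Rothe-northwest r<r′ c<c′ (_ , c′<wr) (r′<w⁻¹c , _) = <-trans r<r′ r′<w⁻¹c , <-trans c<c′ c′<wr

  -- A row a < r has w(a) ≥ c by hypothesis, and w(a) = c is excluded by a < r < w⁻¹(c).
  dominant-Rothe : ∀ {r c} → Rothe w (r , c) → (∀ a → a Fin.< r → ¬ w ⟨$⟩ʳ a Fin.< c) →
                   ∀ {a} → a Fin.≤ r → Rothe w (a , c)
  dominant-Rothe {r} {c} (r<w⁻¹c , c<wr) dominant {a} a≤r with m≤n⇒m<n∨m≡n a≤r
  ... | inj₂ a≡r with refl ← toℕ-injective a≡r = r<w⁻¹c , c<wr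
  ... | inj₁ a<r = a<w⁻¹c , ≤∧≢⇒< (≮⇒≥ (dominant a a<r)) c≢wa
    where
    a<w⁻¹c : a Fin.< w ⟨$⟩ˡ c
    a<w⁻¹c = ≤-<-trans a≤r r<w⁻¹c
    c≢wa : toℕ c ≢ toℕ (w ⟨$⟩ʳ a)
    c≢wa c≡wa = <-irrefl (cong toℕ (sym w⁻¹c≡a)) a<w⁻¹c
      where w⁻¹c≡a = trans (cong (w ⟨$⟩ˡ_) (toℕ-injective c≡wa)) (inverseˡ w)

  -- A column of D(w) that is full down to row r leaves no freedom to a flagged strict filling.
  dominant-Mem : ∀ {T} → Semistandard w T →
                 ∀ {r c} → Rothe w (r , c) → (∀ a → a Fin.< r → ¬ w ⟨$⟩ʳ a Fin.< c) →
                 ∀ {a} → a Fin.≤ r → Mem w T a c a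
  dominant-Mem {T} T-ss {r} {c} d dominant {a} a≤r =
    subst (Mem w T a c) (toℕ-injective (≤-antisym (flag y∈) (bounded (toℕ a) refl a≤r y∈))) y∈
    where
    open Semistandard T-ss
    element : ∀ {a} → a Fin.≤ r → ∃[ y ] Mem w T a c y
    element a≤r = _ , proj₁ (min-IsMin w T (dominant-Rothe d dominant a≤r))
    y∈ = proj₂ (element a≤r)
    -- Entries strictly increase down the full column from row 0, so those of row `a` are at least
    -- `a`; the flag gives the other bound.
    bounded : ∀ k {a y} → toℕ a ≡ k → a Fin.≤ r → Mem w T a c y → a Fin.≤ y
    bounded zero    {a} {y} a≡0 _ _ = subst (_≤ toℕ y) (sym a≡0) z≤n
    bounded (suc k) {a} {y} a≡1+k a≤r y∈
      with a₀ , a≡1+a₀ ← pred-Fin (subst (0 <_) (sym a≡1+k) (s≤s z≤n)) =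
      subst (_≤ toℕ y) (sym a≡1+a₀)
        (≤-<-trans (bounded k (suc-injective (trans (sym a≡1+a₀) a≡1+k)) a₀≤r
                            (proj₂ (element a₀≤r)))
                   (column a₀<a (proj₂ (element a₀≤r)) y∈))
      where
      a₀<a = ≤-reflexive (sym a≡1+a₀)
      a₀≤r = ≤-trans (<⇒≤ a₀<a) a≤r

  IsGhost : Filling w → Fin n → Fin n → Pred (Fin n) 0ℓ
  IsGhost T r c a = Mem w T r c a × (∃[ b ] (Mem w T r c b × b Fin.< a))

  Ghost-Θ⁺ : ∀ {T : SVRT w} {r c a} → IsGhost (proj₁ T) r c a → Ghost (Θ w T) (a , c)
  Ghost-Θ⁺ {T , _} {r} {c} ((d , a∈) , b , (_ , b∈) , b<a) =
    r , d , a∈ , ≤-<-trans (min-≤ (T r c d) b∈) b<a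

  Ghost-Θ⁻ : ∀ {T : SVRT w} {c a} → Ghost (Θ w T) (a , c) → ∃[ r ] IsGhost (proj₁ T) r c a
  Ghost-Θ⁻ {T , _} {c} (r , d , a∈ , m<a) =
    r , (d , a∈) , min (T r c d) , (d , min-∈ (T r c d)) , m<a

-- Lifting a move from diagrams to tableaux.

-- The effect on a tableau of a move at row i: in column j, the entries i′+1, …, i
-- slide up by one row.  The two kinds of move differ only in whether i is kept.
module Move {n : ℕ} (w : Permutation′ n) (avoids : Avoids1432 w) (T* : SVRT w)
  {i j i′ : Fin n} (movable : Movable (Θ w T*) i j i′)
  (Keep : Pred (Fin n) 0ℓ) (Keep? : Decidable Keep)
  (keep⁺ : ∀ {a} → i Fin.< a → Keep a) (keep⁻ : ∀ {a} → Keep a → i Fin.≤ a) where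

  private
    T = proj₁ T*
    T-semistandard = IsSVRT⇒Semistandard w (proj₂ T*)
  open Movable movable
  open Semistandard T-semistandard

  -- `b` is an old entry of the run, and `a` is its new row. `Keep` can differ from `i < a` only at
  -- `i` itself, which a K-move retains as a ghost.
  Slides Keeps NewMem : Fin n → Fin n → Pred (Fin n) 0ℓ
  Slides r c a = c ≡ j × ∃[ b ] (toℕ b ≡ suc (toℕ a) × i′ Fin.< b × b Fin.≤ i × Mem w T r c b)
  Keeps r c a  = Mem w T r c a × (c ≢ j ⊎ a Fin.< i′ ⊎ Keep a)
  NewMem r c a = Slides r c a ⊎ Keeps r c a

  NewMem? : ∀ r c → Decidable (NewMem r c)
  NewMem? r c a =
    ((c ≟ j) ×-dec any? λ b →
      (toℕ b ℕ.≟ suc (toℕ a)) ×-dec (i′ Finₚ.<? b) ×-dec (b Finₚ.≤? i) ×-dec Mem? b)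
    ⊎-dec (Mem? a ×-dec (¬? (c ≟ j) ⊎-dec ((a Finₚ.<? i′) ⊎-dec Keep? a)))
    where
    Mem? : Decidable (Mem w T r c)
    Mem? b = dec-Σ (Rothe? w (r , c)) (λ d → b ∈? NonemptySubset.set (T r c d))

  NewMem⇒Rothe : ∀ {r c a} → NewMem r c a → Rothe w (r , c)
  NewMem⇒Rothe (inj₁ (_ , _ , _ , _ , _ , d , _)) = d
  NewMem⇒Rothe (inj₂ ((d , _) , _))               = d

  vacant-Mem : ∀ {r} → ¬ Mem w T r j i′
  vacant-Mem p = vacant (Occupied-Θ⁺ w {T*} p)

  -- Maximality of `i′` forbids vacant rows between `i′` and `i`, and the occupied ones are boxes.
  allBoxes-IsMin : ∀ {b} → i′ Fin.< b → b Fin.≤ i → ∃[ r ] IsMin w T r j b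
  allBoxes-IsMin {b} i′<b b≤i = Box-Θ⁻ w {T*} (allBoxes b i′<b b≤i occupied)
    where
    occupied : Occupied (Θ w T*) (b , j)
    occupied with Occupied? (Θ w T*) (b , j) | m≤n⇒m<n∨m≡n b≤i
    ... | yes occ | _ = occ
    ... | no _    | inj₂ b≡i with refl ← toℕ-injective b≡i = inj₁ box
    occupied | no ¬occ | inj₁ b<i = contradiction (maximal b b<i ¬occ) (<⇒≱ i′<b)

  -- The cell owning an entry of the run is unique, so it is the one with this minimum: ghosts never
  -- slide.
  Mem⇒IsMin : ∀ {r b} → i′ Fin.< b → b Fin.≤ i → Mem w T r j b → IsMin w T r j b
  Mem⇒IsMin i′<b b≤i p with r , q ← allBoxes-IsMin i′<b b≤i with refl ← owner-unique p (proj₁ q) = q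

  -- Here `i` in column `j` counts as sliding even if a K-move also keeps it; the row `i′` of that
  -- column is vacant and needs no case.
  data Position (r c a : Fin n) : Set where
    kept  : c ≢ j ⊎ a Fin.< i′ ⊎ i Fin.< a → Position r c a
    slide : c ≡ j → i′ Fin.< a → a Fin.≤ i → Position r c a

  locate : ∀ {r c a} → Mem w T r c a → Position r c a
  locate {r} {c} {a} p with c ≟ j | Finₚ.<-cmp a i′ | i Finₚ.<? a
  ... | no c≢j   | _             | _       = kept (inj₁ c≢j)
  ... | yes _    | tri< a<i′ _ _ | _       = kept (inj₂ (inj₁ a<i′))
  ... | yes refl | tri≈ _ refl _ | _       = contradiction p vacant-Mem
  ... | yes _    | tri> _ _ _    | yes i<a = kept (inj₂ (inj₂ i<a))
  ... | yes refl | tri> _ _ i′<a | no i≮a  = slide refl i′<a (≮⇒≥ i≮a)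

  keeps : ∀ {r c a} → Mem w T r c a → c ≢ j ⊎ a Fin.< i′ ⊎ i Fin.< a → NewMem r c a
  keeps p (inj₁ c≢j)         = inj₂ (p , inj₁ c≢j)
  keeps p (inj₂ (inj₁ a<i′)) = inj₂ (p , inj₂ (inj₁ a<i′))
  keeps p (inj₂ (inj₂ i<a))  = inj₂ (p , inj₂ (inj₂ (keep⁺ i<a)))

  slides : ∀ {r b} → Mem w T r j b → i′ Fin.< b → b Fin.≤ i →
           Σ[ a ∈ Fin n ] (toℕ b ≡ suc (toℕ a) × NewMem r j a)
  slides {b = b} p i′<b b≤i with a , b≡1+a ← pred-Fin (≤-<-trans z≤n i′<b) =
    a , b≡1+a , inj₁ (refl , b , b≡1+a , i′<b , b≤i , p)

  -- An entry that does not stay moves up one row. This makes the cells of `T′` nonempty and bounds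
  -- their minima by the old entries.
  descend : ∀ {r c b} → Mem w T r c b → ∃[ a ] (NewMem r c a × a Fin.≤ b)
  descend {b = b} p with locate p
  ... | kept k = b , keeps p k , ≤-refl
  ... | slide refl i′<b b≤i with a , b≡1+a , q ← slides p i′<b b≤i =
        a , q , subst (toℕ a ≤_) (sym b≡1+a) (n≤1+n _)

  T′ : Filling w
  T′ = fromPred w NewMem NewMem? λ r c d →
    let (a , q , _) = descend (d , min-∈ (T r c d)) in a , q

  Mem′⁺ : ∀ {r c a} → NewMem r c a → Mem w T′ r c a
  Mem′⁺ {r} {c} q = NewMem⇒Rothe q , ∈-tabulate⁺ (NewMem? r c) q

  Mem′⁻ : ∀ {r c a} → Mem w T′ r c a → NewMem r c a
  Mem′⁻ {r} {c} (_ , a∈) = ∈-tabulate⁻ (NewMem? r c) a∈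

  -- If b did occur in (r , c′), then by 1432-avoidance the occurrences of b, b+1, …, i in
  -- column j would force the same entries in column c′, and row i would extend past column j.
  no-entry-right : ∀ k {r c′ b} → toℕ b + k ≡ toℕ i → i′ Fin.< b → j Fin.< c′ →
                   Mem w T r j b → ¬ Mem w T r c′ b
  no-entry-right zero {b = b} b+0≡i _ j<c′ _ q
    with refl ← toℕ-injective (trans (sym (+-identityʳ (toℕ b))) b+0≡i) =
    <⇒≱ j<c′ (rightmost _ (Occupied-Θ⁺ w {T*} q))
  no-entry-right (suc k) {r} {c′} {b} b+1+k≡i i′<b j<c′ p q
    with b⁺ , b⁺≡1+b ← suc-Fin {i = i} (subst (toℕ b <_) b+1+k≡i (m<m+n (toℕ b) (s≤s z≤n)))
    with b⁺+k≡i ← trans (cong (_+ k) b⁺≡1+b) (trans (sym (+-suc (toℕ b) k)) b+1+k≡i)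
    with i′<b⁺ ← subst (toℕ i′ <_) (sym b⁺≡1+b) (<-trans i′<b (n<1+n _))
    with x , x-min@(x∋b⁺ , b⁺≤) ← allBoxes-IsMin i′<b⁺ (subst (toℕ b⁺ ≤_) b⁺+k≡i (m≤m+n _ k)) =
    no-entry-right k b⁺+k≡i i′<b⁺ j<c′ x∋b⁺
      -- The minimum `y` of (x, c′) is b + 1: it is at most the entry b + 1 of (x, j), and it
      -- exceeds the entry b of (r, c′).
      (subst (Mem w T x c′)
        (toℕ-injective (≤-antisym (row j<c′ y∈ x∋b⁺)
          (subst (_≤ toℕ y) (sym b⁺≡1+b) (column r<x q y∈))))
        y∈)
    where
    b<b⁺ : b Fin.< b⁺
    b<b⁺ = ≤-reflexive (sym b⁺≡1+b)
    -- Were x = r, the smaller entry `b` would lie in a cell with minimum b + 1.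
    r<x : r Fin.< x
    r<x = ≤∧≢⇒< (owner-mono p x∋b⁺ b<b⁺)
                λ r≡x → <⇒≱ b<b⁺ (b⁺≤ b (subst (λ r → Mem w T r j b) (toℕ-injective r≡x) p))
    d : Rothe w (x , c′)
    d with any? (λ a → (a Finₚ.<? r) ×-dec (w ⟨$⟩ʳ a Finₚ.<? j))
    ... | yes (a , a<r , wa<j) =
          1432-Rothe w avoids a<r wa<j r<x j<c′ (proj₁ x∋b⁺) (proj₁ q)
    -- Otherwise column `j` of D(w) is full down to row `r`, so its row i′ < r would contain the
    -- entry `i′`, which is vacant.
    ... | no ¬a = contradiction
          (dominant-Mem w T-semistandard (proj₁ p) (λ a a<r wa<j → ¬a (a , a<r , wa<j))
            (<⇒≤ (<-≤-trans i′<b (flag p))))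
          vacant-Mem
    y = min (T x c′ d)
    y∈ : Mem w T x c′ y
    y∈ = d , min-∈ (T x c′ d)

  T′-semistandard : Semistandard w T′
  T′-semistandard = record
    { row    = λ c<c′ p q → row′ c<c′ (Mem′⁻ p) (Mem′⁻ q)
    ; column = λ r<r′ p q → column′ r<r′ (Mem′⁻ p) (Mem′⁻ q)
    ; flag   = λ p → flag′ (Mem′⁻ p)
    }
    where
    row′ : ∀ {r c c′ a b} → c Fin.< c′ → NewMem r c′ a → NewMem r c b → a Fin.≤ b
    row′ c<c′ (inj₁ (refl , _)) (inj₁ (refl , _)) = contradiction c<c′ (<-irrefl refl)
    row′ {a = a} {b} c<c′ (inj₁ (_ , a⁺ , eq , _ , _ , p)) (inj₂ (q , _)) =
      ≤-trans (n≤1+n (toℕ a)) (subst (_≤ toℕ b) eq (row c<c′ p q))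
    -- The left entry drops by one while the right one stays, so equality of `a` and `b⁺` must be
    -- excluded; this is where 1432-avoidance enters.
    row′ {r} {c} {c′} {a} {b} c<c′ (inj₂ (p , _)) (inj₁ (refl , b⁺ , eq , i′<b⁺ , b⁺≤i , q)) =
      s≤s⁻¹ (subst (toℕ a <_) eq (≤∧≢⇒< (row c<c′ p q) a≢b⁺))
      where
      a≢b⁺ : toℕ a ≢ toℕ b⁺
      a≢b⁺ a≡b⁺ = no-entry-right _ (m+[n∸m]≡n b⁺≤i) i′<b⁺ c<c′ q
                    (subst (Mem w T r c′) (toℕ-injective a≡b⁺) p)
    row′ c<c′ (inj₂ (p , _)) (inj₂ (q , _)) = row c<c′ p q
    column′ : ∀ {r r′ c a b} → r Fin.< r′ → NewMem r c a → NewMem r′ c b → a Fin.< b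
    column′ r<r′ (inj₁ (_ , a⁺ , a-eq , _ , _ , p)) (inj₁ (_ , b⁺ , b-eq , _ , _ , q)) =
      s≤s⁻¹ (subst₂ _<_ a-eq b-eq (column r<r′ p q))
    column′ {b = b} r<r′ (inj₁ (_ , a⁺ , eq , _ , _ , p)) (inj₂ (q , _)) =
      <-trans (n<1+n _) (subst (_< toℕ b) eq (column r<r′ p q))
    -- The lower entry lands in one of the rows `i′`, ..., i - 1; kept entries of column `j` avoid
    -- these rows.
    column′ {a = a} {b} r<r′ (inj₂ (p , k)) (inj₁ (refl , b⁺ , eq , i′<b⁺ , b⁺≤i , q)) =
      ≤∧≢⇒< (s≤s⁻¹ (subst (toℕ a <_) eq (column r<r′ p q))) (a≢b k)
      where
      a≢b : _ → toℕ a ≢ toℕ b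
      a≢b (inj₁ c≢j) _ = c≢j refl
      a≢b (inj₂ (inj₁ a<i′)) a≡b =
        <⇒≱ i′<b⁺ (subst (_≤ toℕ i′) (trans (cong suc a≡b) (sym eq)) a<i′)
      a≢b (inj₂ (inj₂ ka)) a≡b =
        <⇒≱ (subst (_≤ toℕ i) eq b⁺≤i) (subst (toℕ i ≤_) a≡b (keep⁻ ka))
    column′ r<r′ (inj₂ (p , _)) (inj₂ (q , _)) = column r<r′ p q
    flag′ : ∀ {r c a} → NewMem r c a → a Fin.≤ r
    flag′ {r} (inj₁ (_ , a⁺ , eq , _ , _ , p)) = ≤-trans (n≤1+n _) (subst (_≤ toℕ r) eq (flag p))
    flag′ (inj₂ (p , _)) = flag p

  T′* : SVRT w
  T′* = T′ , Semistandard⇒IsSVRT w T′-semistandard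

  -- The entry a + 1 was the minimum of its cell, and no entry drops by more than one.
  slid-IsMin : ∀ {a} → i′ Fin.≤ a → a Fin.< i → ∃[ r ] IsMin w T′ r j a
  slid-IsMin {a} i′≤a a<i
    with b , b≡1+a ← suc-Fin a<i
    with i′<b ← subst (toℕ i′ <_) (sym b≡1+a) (s≤s i′≤a) | b≤i ← subst (_≤ toℕ i) (sym b≡1+a) a<i
    with r , p , b≤ ← allBoxes-IsMin i′<b b≤i =
    r , Mem′⁺ (inj₁ (refl , b , b≡1+a , i′<b , b≤i , p)) , λ x q → lower (Mem′⁻ q)
    where
    lower : ∀ {x} → NewMem r j x → a Fin.≤ x
    lower (inj₁ (_ , x⁺ , eq , _ , _ , q)) = s≤s⁻¹ (subst₂ _≤_ b≡1+a eq (b≤ x⁺ q))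
    lower {x} (inj₂ (q , _)) = <⇒≤ (subst (_≤ toℕ x) b≡1+a (b≤ x q))

  Box′⇒Box : ∀ {r c a} → IsMin w T′ r c a →
             ((Box (Θ w T*) ∖ ｛ i , j ｝) ∪ ｛ i′ , j ｝) (a , c)
  Box′⇒Box {r} {c} {a} (p′ , a≤) with Mem′⁻ p′
  -- A slid entry reaches the vacancy `i′` or the row of another box of the run.
  ... | inj₁ (refl , a⁺ , eq , i′<a⁺ , a⁺≤i , _)
        with m≤n⇒m<n∨m≡n (s≤s⁻¹ (subst (toℕ i′ <_) eq i′<a⁺))
  ...   | inj₂ i′≡a = inj₂ (cong (_, c) (toℕ-injective i′≡a))
  ...   | inj₁ i′<a = inj₁
          ( Box-Θ⁺ w {T*} (proj₂ (allBoxes-IsMin i′<a (<⇒≤ a<i)))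
          , λ { refl → <-irrefl refl a<i } )
    where a<i = subst (_≤ toℕ i) eq a⁺≤i
  Box′⇒Box {r} {c} {a} (p′ , a≤) | inj₂ (p , _) = inj₁ (Box-Θ⁺ w {T*} (p , a≤b) , i,j≢a,c)
    where
    a≤b : ∀ b → Mem w T r c b → a Fin.≤ b
    a≤b b q with b′ , q′ , b′≤b ← descend q = ≤-trans (a≤ b′ (Mem′⁺ q′)) b′≤b
    -- A kept `i` is not a minimum, since its cell also receives i - 1.
    i,j≢a,c : (i , j) ≢ (a , c)
    i,j≢a,c refl
      with b , eq , q ← slides p above ≤-refl = <⇒≱ (≤-reflexive (sym eq)) (a≤ b (Mem′⁺ q))

  Box⇒Box′ : ((Box (Θ w T*) ∖ ｛ i , j ｝) ∪ ｛ i′ , j ｝) ⊆ Box (Θ w T′*)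
  Box⇒Box′ (inj₂ refl) = Box-Θ⁺ w {T′*} (proj₂ (slid-IsMin ≤-refl above))
  Box⇒Box′ {a , c} (inj₁ (b , i,j≢a,c)) with r , p , a≤ ← Box-Θ⁻ w {T*} b with locate p
  ... | slide refl i′<a a≤i = Box-Θ⁺ w {T′*} (proj₂ (slid-IsMin (<⇒≤ i′<a)
          (≤∧≢⇒< a≤i λ a≡i → i,j≢a,c (cong (_, j) (sym (toℕ-injective a≡i))))))
  ... | kept k = Box-Θ⁺ w {T′*} (Mem′⁺ (keeps p k) , λ x q → lower (Mem′⁻ q))
    where
    lower : ∀ {x} → NewMem r c x → a Fin.≤ x
    lower {x} (inj₂ (q , _)) = a≤ x q
    lower {x} (inj₁ (refl , x⁺ , eq , i′<x⁺ , x⁺≤i , q)) =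
      s≤s⁻¹ (subst (toℕ a <_) eq (≤∧≢⇒< (a≤ x⁺ q) (a≢x⁺ k)))
      where
      a≢x⁺ : _ → toℕ a ≢ toℕ x⁺
      a≢x⁺ (inj₁ c≢j) _ = c≢j refl
      a≢x⁺ (inj₂ (inj₁ a<i′)) a≡x⁺ = <⇒≱ a<i′ (<⇒≤ (subst (toℕ i′ <_) (sym a≡x⁺) i′<x⁺))
      a≢x⁺ (inj₂ (inj₂ i<a)) a≡x⁺ = <⇒≱ i<a (subst (_≤ toℕ i) (sym a≡x⁺) x⁺≤i)

  Box-move : Box (Θ w T′*) ≐ (Box (Θ w T*) ∖ ｛ i , j ｝) ∪ ｛ i′ , j ｝
  Box-move = (λ b → Box′⇒Box (proj₂ (Box-Θ⁻ w {T′*} b))) , Box⇒Box′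

  -- A slid entry was a minimum and remains one, so a new ghost is a kept entry. It was a ghost
  -- before unless the smaller entry is its own slid copy, and then `a` is `i`.
  Ghost′⇒Ghost : ∀ {r c a} → IsGhost w T′ r c a →
                 Ghost (Θ w T*) (a , c) ⊎ Keep i × (i , j) ≡ (a , c)
  Ghost′⇒Ghost {r} {c} {a} (p′ , b , q′ , b<a) = case (Mem′⁻ p′) (Mem′⁻ q′)
    where
    case : NewMem r c a → NewMem r c b → Ghost (Θ w T*) (a , c) ⊎ Keep i × (i , j) ≡ (a , c)
    case (inj₁ (refl , a⁺ , eq , i′<a⁺ , a⁺≤i , p)) (inj₁ (_ , b⁺ , eq′ , _ , _ , q)) =
      contradiction (subst₂ _≤_ eq eq′ (proj₂ (Mem⇒IsMin i′<a⁺ a⁺≤i p) b⁺ q)) (<⇒≱ (s≤s b<a))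
    case (inj₁ (refl , a⁺ , eq , i′<a⁺ , a⁺≤i , p)) (inj₂ (q , _)) =
      contradiction (subst (_≤ toℕ b) eq (proj₂ (Mem⇒IsMin i′<a⁺ a⁺≤i p) b q))
        (<⇒≱ (<-trans b<a (n<1+n _)))
    case (inj₂ (p , _)) (inj₂ (q , _)) = inj₁ (Ghost-Θ⁺ w {T*} (p , b , q , b<a))
    case (inj₂ (p , k)) (inj₁ (refl , b⁺ , eq , i′<b⁺ , b⁺≤i , q))
      with m≤n⇒m<n∨m≡n (subst (_≤ toℕ a) (sym eq) b<a)
    ... | inj₁ b⁺<a = inj₁ (Ghost-Θ⁺ w {T*} (p , b⁺ , q , b⁺<a))
    ... | inj₂ b⁺≡a with refl ← toℕ-injective b⁺≡a with k
    ...   | inj₁ c≢j = contradiction refl c≢j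
    ...   | inj₂ (inj₁ a<i′) = contradiction i′<b⁺ (<⇒≱ a<i′ ∘ <⇒≤)
    ...   | inj₂ (inj₂ ka) with refl ← toℕ-injective (≤-antisym b⁺≤i (keep⁻ ka)) = inj₂ (ka , refl)

  Ghost⇒Ghost′ : ∀ {a c} → Ghost (Θ w T*) (a , c) → Ghost (Θ w T′*) (a , c)
  Ghost⇒Ghost′ {a} {c} g with r , p , b , q , b<a ← Ghost-Θ⁻ w {T*} g with locate p | descend q
  ... | kept k | b′ , q′ , b′≤b =
        Ghost-Θ⁺ w {T′*} (Mem′⁺ (keeps p k) , b′ , Mem′⁺ q′ , ≤-<-trans b′≤b b<a)
  ... | slide refl i′<a a≤i | _ = contradiction (proj₂ (Mem⇒IsMin i′<a a≤i p) b q) (<⇒≱ b<a)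

  kept-Ghost′ : Keep i → Ghost (Θ w T′*) (i , j)
  kept-Ghost′ ki with r , p , _ ← Box-Θ⁻ w {T*} box with b , eq , q ← slides p above ≤-refl =
    Ghost-Θ⁺ w {T′*} (Mem′⁺ (inj₂ (p , inj₂ (inj₂ ki))) , b , Mem′⁺ q , ≤-reflexive (sym eq))

-- Every diagram reached by moves comes from a tableau.

module _ {n : ℕ} (w : Permutation′ n) where

  ⟶-Θ : Avoids1432 w → ∀ T {E} → Θ w T ⟶ E → ∃[ T′ ] E ≈ Θ w T′
  ⟶-Θ avoids T (ordinary {i} mv box ghost) =
    T′* , ≐-trans box (≐-sym Box-move) ,
    ≐-trans ghost (Ghost⇒Ghost′ , λ g → Ghost⁻ (Ghost-Θ⁻ w {T′*} g))
    where
    -- The strict order drops `i`; the weak order, used for the K-move, keeps it as the new ghost.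
    open Move w avoids T mv (i Fin.<_) (i Finₚ.<?_) (λ i<a → i<a) <⇒≤
    Ghost⁻ : ∀ {c a} → ∃[ r ] IsGhost w T′ r c a → Ghost (Θ w T) (a , c)
    Ghost⁻ (_ , g′) with Ghost′⇒Ghost g′
    ... | inj₁ g         = g
    ... | inj₂ (i<i , _) = contradiction i<i (<-irrefl refl)
  ⟶-Θ avoids T (K-move {i} {j} mv box ghost) =
    T′* , ≐-trans box (≐-sym Box-move) ,
    ≐-trans ghost (Ghost⁺ , λ g → Ghost⁻ (Ghost-Θ⁻ w {T′*} g))
    where
    open Move w avoids T mv (i Fin.≤_) (i Finₚ.≤?_) <⇒≤ (λ i≤a → i≤a)
    Ghost⁺ : (Ghost (Θ w T) ∪ ｛ i , j ｝) ⊆ Ghost (Θ w T′*)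
    Ghost⁺ (inj₁ g)    = Ghost⇒Ghost′ g
    Ghost⁺ (inj₂ refl) = kept-Ghost′ ≤-refl
    Ghost⁻ : ∀ {c a} → ∃[ r ] IsGhost w T′ r c a → (Ghost (Θ w T) ∪ ｛ i , j ｝) (a , c)
    Ghost⁻ (_ , g′) with Ghost′⇒Ghost g′
    ... | inj₁ g        = inj₁ g
    ... | inj₂ (_ , eq) = inj₂ eq

  initial≈Θ : ∀ T → (∀ {r c a} → Mem w (proj₁ T) r c a → a ≡ r) → initial w ≈ Θ w T
  initial≈Θ T* T∋⇒≡ = (to , from) , ((λ ()) , λ g → noGhost (Ghost-Θ⁻ w {T*} g))
    where
    T = proj₁ T*
    to : Rothe w ⊆ Box (Θ w T*)
    to {r , c} d = Box-Θ⁺ w {T*} (subst (IsMin w T r c) (T∋⇒≡ (proj₁ m)) m)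
      where m = min-IsMin w T d
    from : Box (Θ w T*) ⊆ Rothe w
    from b with r , p@(d , _) , _ ← Box-Θ⁻ w {T*} b with refl ← T∋⇒≡ p = d
    noGhost : ∀ {c a} → ¬ (∃[ r ] IsGhost w T r c a)
    noGhost (r , p , b , q , b<a) with refl ← T∋⇒≡ p | refl ← T∋⇒≡ q = <-irrefl refl b<a

  -- Induction on the moves, starting from the tableau with T(r, c) = {r}.
  KKoh⇒Θ : Avoids1432 w → ∀ {E} → KKoh w E → ∃[ T ] E ≈ Θ w T
  KKoh⇒Θ avoids {E} (start E≈) = T₀* , ≈-trans {E = E} {initial w} {Θ w T₀*} E≈ (initial≈Θ T₀* T₀⁻)
    where
    T₀ : Filling w
    T₀ = fromPred w (λ r c a → a ≡ r) (λ r c a → a ≟ r) λ r c _ → r , refl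
    T₀⁻ : ∀ {r c a} → Mem w T₀ r c a → a ≡ r
    T₀⁻ {r} (_ , a∈) = ∈-tabulate⁻ (_≟ r) a∈
    T₀* : SVRT w
    T₀* = T₀ , Semistandard⇒IsSVRT w {T₀} (record
      { row    = λ _ p q → ≤-reflexive (cong toℕ (trans (T₀⁻ p) (sym (T₀⁻ q))))
      ; column = λ r<r′ p q → subst₂ Fin._<_ (sym (T₀⁻ p)) (sym (T₀⁻ q)) r<r′
      ; flag   = λ p → ≤-reflexive (cong toℕ (T₀⁻ p))
      })
  KKoh⇒Θ avoids (step e E⟶E′) with T , E≈ΘT ← KKoh⇒Θ avoids e =
    ⟶-Θ avoids T (⟶-congˡ E≈ΘT E⟶E′)


-- Undoing a move on a tableau.

-- The inverse of a move: R is the lowest row in which T differs from the initial filling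
-- and (R , j) the leftmost such cell of that row; its minimum m is lowered to i = m + 1.
module InverseMove {n : ℕ} (w : Permutation′ n) (T* : SVRT w) {R j m i : Fin n}
  (m-min : IsMin w (proj₁ T*) R j m) (m<R : m Fin.< R) (i≡1+m : toℕ i ≡ suc (toℕ m))
  (below : ∀ {r c a} → R Fin.< r → Mem w (proj₁ T*) r c a → a ≡ r)
  (left  : ∀ {c a} → c Fin.< j → Mem w (proj₁ T*) R c a → a ≡ R) where

  private
    T = proj₁ T*
  open Semistandard (IsSVRT⇒Semistandard w (proj₂ T*))

  m<i : m Fin.< i
  m<i = ≤-reflexive (sym i≡1+m)

  i≤R : i Fin.≤ R
  i≤R = subst (_≤ toℕ R) (sym i≡1+m) m<R

  Moved : Fin n → Fin n → Set
  Moved r c = r ≡ R × c ≡ j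

  Moved? : ∀ r c → Dec (Moved r c)
  Moved? r c = (r ≟ R) ×-dec (c ≟ j)

  -- If `i` is already in the cell, `m` is merely deleted, and the way back is a K-move; otherwise
  -- it is an ordinary move.
  NewMem : Fin n → Fin n → Pred (Fin n) 0ℓ
  NewMem r c a = (Moved r c × a ≡ i) ⊎ (Mem w T r c a × ¬ (Moved r c × a ≡ m))

  NewMem? : ∀ r c → Decidable (NewMem r c)
  NewMem? r c a =
    (Moved? r c ×-dec (a ≟ i)) ⊎-dec
    (dec-Σ (Rothe? w (r , c)) (λ d → a ∈? NonemptySubset.set (T r c d)) ×-dec
     ¬? (Moved? r c ×-dec (a ≟ m)))

  NewMem-inhabited : ∀ r c → Rothe w (r , c) → ∃[ a ] NewMem r c a
  NewMem-inhabited r c d with Moved? r c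
  ... | yes moved = i , inj₁ (moved , refl)
  ... | no ¬moved = min (T r c d) , inj₂ (proj₁ (min-IsMin w T d) , ¬moved ∘ proj₁)

  T′ : Filling w
  T′ = fromPred w NewMem NewMem? NewMem-inhabited

  Mem′⁺ : ∀ {r c a} → NewMem r c a → Mem w T′ r c a
  Mem′⁺ {r} {c} q = rothe q , ∈-tabulate⁺ (NewMem? r c) q
    where
    rothe : NewMem r c _ → Rothe w (r , c)
    rothe (inj₁ ((refl , refl) , _)) = proj₁ (proj₁ m-min)
    rothe (inj₂ ((d , _) , _))       = d

  Mem′⁻ : ∀ {r c a} → Mem w T′ r c a → NewMem r c a
  Mem′⁻ {r} {c} (_ , a∈) = ∈-tabulate⁻ (NewMem? r c) a∈

  Mem⇒Mem′ : ∀ {r c a} → ¬ Moved r c → Mem w T r c a → Mem w T′ r c a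
  Mem⇒Mem′ ¬moved p = Mem′⁺ (inj₂ (p , ¬moved ∘ proj₁))

  Mem′⇒Mem : ∀ {r c a} → ¬ Moved r c → Mem w T′ r c a → Mem w T r c a
  Mem′⇒Mem ¬moved p with Mem′⁻ p
  ... | inj₁ (moved , _) = contradiction moved ¬moved
  ... | inj₂ (q , _)     = q

  i∈T′ : Mem w T′ R j i
  i∈T′ = Mem′⁺ (inj₁ ((refl , refl) , refl))

  i-min : ∀ {a} → Mem w T′ R j a → i Fin.≤ a
  i-min {a} p with Mem′⁻ p
  ... | inj₁ (_ , refl) = ≤-refl
  ... | inj₂ (q , ¬m)   = subst (_≤ toℕ a) (sym i≡1+m)
          (≤∧≢⇒< (proj₂ m-min a q) λ m≡a → ¬m ((refl , refl) , sym (toℕ-injective m≡a)))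

  T′-semistandard : Semistandard w T′
  T′-semistandard = record
    { row    = λ c<c′ p q → row′ c<c′ (Mem′⁻ p) (Mem′⁻ q)
    ; column = λ r<r′ p q → column′ r<r′ (Mem′⁻ p) (Mem′⁻ q)
    ; flag   = λ p → flag′ (Mem′⁻ p)
    }
    where
    row′ : ∀ {r c c′ a b} → c Fin.< c′ → NewMem r c′ a → NewMem r c b → a Fin.≤ b
    row′ c<c′ (inj₁ (_ , refl)) (inj₁ (_ , refl)) = ≤-refl
    row′ c<c′ (inj₁ ((refl , refl) , refl)) (inj₂ (q , _)) with refl ← left c<c′ q = i≤R
    row′ c<c′ (inj₂ (p , _)) (inj₁ ((refl , refl) , refl)) =
      ≤-trans (row c<c′ p (proj₁ m-min)) (<⇒≤ m<i)
    row′ c<c′ (inj₂ (p , _)) (inj₂ (q , _)) = row c<c′ p q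
    column′ : ∀ {r r′ c a b} → r Fin.< r′ → NewMem r c a → NewMem r′ c b → a Fin.< b
    column′ r<r′ (inj₁ ((refl , _) , _)) (inj₁ ((refl , _) , _)) =
      contradiction r<r′ (<-irrefl refl)
    column′ r<r′ (inj₁ ((refl , refl) , refl)) (inj₂ (q , _))
      with refl ← below r<r′ q = ≤-<-trans i≤R r<r′
    column′ r<r′ (inj₂ (p , _)) (inj₁ ((refl , refl) , refl)) =
      <-trans (column r<r′ p (proj₁ m-min)) m<i
    column′ r<r′ (inj₂ (p , _)) (inj₂ (q , _)) = column r<r′ p q
    flag′ : ∀ {r c a} → NewMem r c a → a Fin.≤ r
    flag′ (inj₁ ((refl , _) , refl)) = i≤R
    flag′ (inj₂ (p , _))             = flag p

  private module S′ = Semistandard T′-semistandard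

  T′* : SVRT w
  T′* = T′ , Semistandard⇒IsSVRT w T′-semistandard

  -- Row `m` is directly above row `i`, so `maximal` is immediate and `allBoxes` concerns row `i`
  -- alone; by column strictness `m` occurred in column `j` only in row `R`.
  movable : Movable (Θ w T′*) i j m
  movable = record
    { box       = i-box
    ; rightmost = λ k o → ≮⇒≥ λ j<k → nothing-right j<k (proj₂ (Occupied-Θ⁻ w {T′*} o))
    ; above     = m<i
    ; vacant    = λ o → m-vacant (Mem′⁻ (proj₂ (Occupied-Θ⁻ w {T′*} o)))
    ; maximal   = λ r r<i _ → s≤s⁻¹ (subst (toℕ r <_) i≡1+m r<i)
    ; allBoxes  = λ r m<r r≤i _ → subst (λ r → Box (Θ w T′*) (r , j))
                    (toℕ-injective (≤-antisym (subst (_≤ toℕ r) (sym i≡1+m) m<r) r≤i)) i-box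
    }
    where
    i-box : Box (Θ w T′*) (i , j)
    i-box = Box-Θ⁺ w {T′*} (i∈T′ , λ b → i-min)
    m-vacant : ∀ {r} → ¬ NewMem r j m
    m-vacant (inj₁ (_ , m≡i)) = <-irrefl (cong toℕ m≡i) m<i
    m-vacant (inj₂ (p , ¬m)) with refl ← owner-unique p (proj₁ m-min) = ¬m ((refl , refl) , refl)
    nothing-right : ∀ {k r} → j Fin.< k → ¬ Mem w T′ r k i
    nothing-right {k} {r} j<k p
      with q ← Mem′⇒Mem (λ { (_ , refl) → <-irrefl refl j<k }) p
      with Finₚ.<-cmp r R
    ... | tri≈ _ refl _ = <⇒≱ m<i (row j<k q (proj₁ m-min))
    ... | tri> _ _ R<r with refl ← below R<r q = <⇒≱ R<r i≤R
    -- The cell (r, j) is in D(w) as well; an entry of it is at least `i` by the row condition and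
    -- less than `m` by the column condition.
    ... | tri< r<R _ _ = <⇒≱ m<i (≤-trans (row j<k q x∈) (<⇒≤ (column r<R x∈ (proj₁ m-min))))
      where
      d : Rothe w (r , j)
      d = Rothe-northwest w r<R j<k (proj₁ p) (proj₁ (proj₁ m-min))
      x∈ : Mem w T r j (min (T r j d))
      x∈ = proj₁ (min-IsMin w T d)

  Box-move : Box (Θ w T*) ≐ (Box (Θ w T′*) ∖ ｛ i , j ｝) ∪ ｛ m , j ｝
  Box-move = (λ b → to (proj₂ (Box-Θ⁻ w {T*} b))) , from
    where
    to : ∀ {r c a} → IsMin w T r c a → ((Box (Θ w T′*) ∖ ｛ i , j ｝) ∪ ｛ m , j ｝) (a , c)
    to {r} {c} {a} (p , a≤) with Moved? r c
    ... | yes (refl , refl) =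
          inj₂ (cong (_, j) (toℕ-injective (≤-antisym (proj₂ m-min a p) (a≤ m (proj₁ m-min)))))
    ... | no ¬moved = inj₁
          ( Box-Θ⁺ w {T′*} (Mem⇒Mem′ ¬moved p , λ b q → a≤ b (Mem′⇒Mem ¬moved q))
          , λ { refl → ¬moved (S′.owner-unique (Mem⇒Mem′ ¬moved p) i∈T′ , refl) } )
    from : ((Box (Θ w T′*) ∖ ｛ i , j ｝) ∪ ｛ m , j ｝) ⊆ Box (Θ w T*)
    from (inj₂ refl) = Box-Θ⁺ w {T*} m-min
    from {a , c} (inj₁ (b , i,j≢a,c)) with r , p , a≤ ← Box-Θ⁻ w {T′*} b with Moved? r c
    ... | yes (refl , refl) =
          contradiction (cong (_, j) (toℕ-injective (≤-antisym (i-min p) (a≤ i i∈T′)))) i,j≢a,c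
    ... | no ¬moved = Box-Θ⁺ w {T*} (Mem′⇒Mem ¬moved p , λ b q → a≤ b (Mem⇒Mem′ ¬moved q))

  Ghost⇒Ghost′ : ∀ {a c} → Ghost (Θ w T*) (a , c) →
                 Ghost (Θ w T′*) (a , c) ⊎ (Mem w T R j i × (i , j) ≡ (a , c))
  Ghost⇒Ghost′ {a} {c} g with r , p , b , q , b<a ← Ghost-Θ⁻ w {T*} g with Moved? r c
  ... | no ¬moved = inj₁ (Ghost-Θ⁺ w {T′*} (Mem⇒Mem′ ¬moved p , b , Mem⇒Mem′ ¬moved q , b<a))
  ... | yes (refl , refl) with m<a ← ≤-<-trans (proj₂ m-min b q) b<a with a ≟ i
  ...   | yes refl = inj₂ (p , refl)
  ...   | no a≢i = inj₁ (Ghost-Θ⁺ w {T′*}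
            (Mem′⁺ (inj₂ (p , λ { (_ , refl) → <-irrefl refl m<a })) , i , i∈T′
            , ≤∧≢⇒< (subst (_≤ toℕ a) (sym i≡1+m) m<a) (a≢i ∘ sym ∘ toℕ-injective)))

  Ghost′⇒Ghost : ∀ {a c} → Ghost (Θ w T′*) (a , c) → Ghost (Θ w T*) (a , c)
  Ghost′⇒Ghost {a} {c} g with r , p , b , q , b<a ← Ghost-Θ⁻ w {T′*} g with Moved? r c
  ... | no ¬moved = Ghost-Θ⁺ w {T*} (Mem′⇒Mem ¬moved p , b , Mem′⇒Mem ¬moved q , b<a)
  ... | yes (refl , refl) with i<a ← ≤-<-trans (i-min q) b<a with Mem′⁻ p
  ...   | inj₁ (_ , refl) = contradiction i<a (<-irrefl refl)
  ...   | inj₂ (p , _)    = Ghost-Θ⁺ w {T*} (p , m , proj₁ m-min , <-trans m<i i<a)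

  Θ-move : Θ w T′* ⟶ Θ w T*
  Θ-move with dec-Σ (Rothe? w (R , j)) (λ d → i ∈? NonemptySubset.set (T R j d))
  ... | yes i∈T = K-move movable Box-move (to , from)
    where
    to : Ghost (Θ w T*) ⊆ (Ghost (Θ w T′*) ∪ ｛ i , j ｝)
    to g with Ghost⇒Ghost′ g
    ... | inj₁ g′       = inj₁ g′
    ... | inj₂ (_ , eq) = inj₂ eq
    from : (Ghost (Θ w T′*) ∪ ｛ i , j ｝) ⊆ Ghost (Θ w T*)
    from (inj₁ g′)   = Ghost′⇒Ghost g′
    from (inj₂ refl) = Ghost-Θ⁺ w {T*} (i∈T , m , proj₁ m-min , m<i)
  ... | no i∉T = ordinary movable Box-move (to , Ghost′⇒Ghost)
    where
    to : Ghost (Θ w T*) ⊆ Ghost (Θ w T′*)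
    to g with Ghost⇒Ghost′ g
    ... | inj₁ g′        = g′
    ... | inj₂ (i∈T , _) = contradiction i∈T i∉T

-- Reaching every tableau from the initial diagram.

module _ {n : ℕ} (w : Permutation′ n) where

  -- Cells are treated from the bottom row up, each row from left to right. Finished are the rows
  -- from `R` on and, in row R - 1, the columns before `k`.
  InitialFrom : SVRT w → ℕ → ℕ → Set
  InitialFrom (T , _) R k =
    ∀ {r c a} → R ≤ toℕ r ⊎ (suc (toℕ r) ≡ R × toℕ c < k) → Mem w T r c a → a ≡ r

  InitialFrom-step : ∀ T {R k} →
                     (∀ {r c a} → toℕ r ≡ R → toℕ c ≡ k → Mem w (proj₁ T) r c a → a ≡ r) →
                     InitialFrom T (suc R) k → InitialFrom T (suc R) (suc k)
  InitialFrom-step T cell ini (inj₁ R<r) p = ini (inj₁ R<r) p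
  InitialFrom-step T cell ini (inj₂ (r≡R , c<1+k)) p with m≤n⇒m<n∨m≡n (s≤s⁻¹ c<1+k)
  ... | inj₁ c<k = ini (inj₂ (r≡R , c<k)) p
  ... | inj₂ c≡k = cell (suc-injective r≡R) c≡k p

  -- Induction on `fuel`, a bound for the distance of the entries of (R, j) from `R`. Each inverse
  -- move raises the minimum by one; once it is `R`, the flag forces the cell to be {R}.
  reachCell : ∀ {R j : Fin n} → Rothe w (R , j) →
              (∀ T → InitialFrom T (suc (toℕ R)) (suc (toℕ j)) → KKoh w (Θ w T)) →
              ∀ fuel T → (∀ {a} → Mem w (proj₁ T) R j a → toℕ R ≤ toℕ a + fuel) →
              InitialFrom T (suc (toℕ R)) (toℕ j) → KKoh w (Θ w T)
  reachCell {R} {j} d next fuel T* bound ini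
    with m-min@(m∈ , m≤) ← min-IsMin w (proj₁ T*) d
    with m≤n⇒m<n∨m≡n (Semistandard.flag (IsSVRT⇒Semistandard w (proj₂ T*)) m∈)
  ... | inj₂ m≡R = next T* (InitialFrom-step T* cell ini)
    where
    open Semistandard (IsSVRT⇒Semistandard w (proj₂ T*))
    cell : ∀ {r c a} → toℕ r ≡ toℕ R → toℕ c ≡ toℕ j → Mem w (proj₁ T*) r c a → a ≡ r
    cell {a = a} r≡R c≡j p with refl ← toℕ-injective r≡R | refl ← toℕ-injective c≡j =
      toℕ-injective (≤-antisym (flag p) (subst (_≤ toℕ a) m≡R (m≤ a p)))
  reachCell {R} {j} d next zero T* bound ini | inj₁ m<R =
    contradiction
      (subst (toℕ R ≤_) (+-identityʳ _) (bound (proj₁ (min-IsMin w (proj₁ T*) d))))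
      (<⇒≱ m<R)
  reachCell {R} {j} d next (suc fuel) T* bound ini | inj₁ m<R
    with i , i≡1+m ← suc-Fin m<R =
    step (reachCell d next fuel T′* bound′ ini′) Θ-move
    where
    open InverseMove w T* m-min m<R i≡1+m
      (λ R<r → ini (inj₁ R<r)) (λ c<j → ini (inj₂ (refl , c<j)))
    bound′ : ∀ {a} → Mem w T′ R j a → toℕ R ≤ toℕ a + fuel
    bound′ p = ≤-trans
      (subst (toℕ R ≤_) (trans (+-suc _ fuel) (cong (_+ fuel) (sym i≡1+m)))
        (bound (proj₁ m-min)))
      (+-monoˡ-≤ fuel (i-min p))
    ini′ : InitialFrom T′* (suc (toℕ R)) (toℕ j)
    ini′ {r} {c} final p = ini final (Mem′⇒Mem (λ { (refl , refl) → unfinished final }) p)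
      where
      unfinished : ¬ (toℕ R < toℕ R ⊎ (suc (toℕ R) ≡ suc (toℕ R) × toℕ j < toℕ j))
      unfinished (inj₁ R<R)       = <-irrefl refl R<R
      unfinished (inj₂ (_ , j<j)) = <-irrefl refl j<j

  -- `k` is the column treated next and `l` the number of columns left; after the last column, row
  -- `R` joins the finished rows.
  reachRow : ∀ {R : Fin n} → (∀ T → InitialFrom T (toℕ R) 0 → KKoh w (Θ w T)) →
             ∀ l k → k + l ≡ n → ∀ T → InitialFrom T (suc (toℕ R)) k → KKoh w (Θ w T)
  reachRow {R} next zero k k+0≡n T ini = next T λ { (inj₁ R≤r) p → row-final R≤r p }
    where
    row-final : ∀ {r c a} → toℕ R ≤ toℕ r → Mem w (proj₁ T) r c a → a ≡ r
    row-final {c = c} R≤r p with m≤n⇒m<n∨m≡n R≤r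
    ... | inj₁ R<r = ini (inj₁ R<r) p
    ... | inj₂ R≡r = ini (inj₂ (cong suc (sym R≡r) , c<k)) p
      where c<k = subst (toℕ c <_) (trans (sym k+0≡n) (+-identityʳ k)) (toℕ<n c)
  reachRow {R} next (suc l) k k+1+l≡n T ini = cell (Rothe? w (R , j))
    where
    k<n : k < n
    k<n = subst (k <_) k+1+l≡n (m<m+n k (s≤s z≤n))
    j : Fin n
    j = fromℕ< k<n
    j≡k : toℕ j ≡ k
    j≡k = toℕ-fromℕ< k<n
    next′ : ∀ T → InitialFrom T (suc (toℕ R)) (suc k) → KKoh w (Θ w T)
    next′ = reachRow next l (suc k) (trans (sym (+-suc k l)) k+1+l≡n)
    cell : Dec (Rothe w (R , j)) → KKoh w (Θ w T)
    cell (yes d) = reachCell d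
      (subst (λ k → ∀ T → InitialFrom T (suc (toℕ R)) (suc k) → KKoh w (Θ w T)) (sym j≡k) next′)
      -- Fuel `R` suffices, as no entry is below 0.
      (toℕ R) T (λ {a} _ → m≤n+m (toℕ R) (toℕ a))
      (subst (λ k → InitialFrom T (suc (toℕ R)) k) (sym j≡k) ini)
    cell (no ¬d) = next′ T (InitialFrom-step T absent ini)
      where
      absent : ∀ {r c a} → toℕ r ≡ toℕ R → toℕ c ≡ k → Mem w (proj₁ T) r c a → a ≡ r
      absent r≡R c≡k (d , _)
        with refl ← toℕ-injective r≡R | refl ← toℕ-injective (trans c≡k (sym j≡k)) =
        contradiction d ¬d

  -- Induction on the number `R` of unfinished rows; with none left, `T` has the initial diagram.
  reach : ∀ R → R ≤ n → ∀ T → InitialFrom T R 0 → KKoh w (Θ w T)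
  reach zero R≤n T ini = start (≈-sym {E = initial w} {Θ w T} (initial≈Θ w T (ini (inj₁ z≤n))))
  reach (suc R) R<n T ini =
    reachRow {fromℕ< R<n} (subst Reach (sym R≡) (reach R (<⇒≤ R<n))) n 0 refl T
      (subst (λ R → InitialFrom T (suc R) 0) (sym R≡) ini)
    where
    R≡ = toℕ-fromℕ< R<n
    Reach : ℕ → Set₁
    Reach R = ∀ T → InitialFrom T R 0 → KKoh w (Θ w T)

  Θ∈KKoh : ∀ T → KKoh w (Θ w T)
  -- At the outset no cell is finished, because no row index reaches `n`.
  Θ∈KKoh T = reach n ≤-refl T λ
    { {r} (inj₁ n≤r) → contradiction n≤r (<⇒≱ (toℕ<n r))
    ; (inj₂ (_ , ())) }

  -- Compatibility with equality, and the bijection.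

  -- Passes the tableau conditions to `Ξ w E` from the tableau whose diagram is `E`.
  Semistandard-cong : ∀ {T T′} → (∀ r c (d : Rothe w (r , c)) → T′ r c d ≡ T r c d) →
                      Semistandard w T → Semistandard w T′
  Semistandard-cong {T} {T′} eq T-ss = record
    { row    = λ c<c′ p q → row c<c′ (transport p) (transport q)
    ; column = λ r<r′ p q → column r<r′ (transport p) (transport q)
    ; flag   = λ p → flag (transport p)
    }
    where
    open Semistandard T-ss
    transport : ∀ {r c a} → Mem w T′ r c a → Mem w T r c a
    transport {r} {c} {a} (d , a∈) = d , subst (a ∈ₛ_) (eq r c d) a∈

  Θ-cong : ∀ {T T′} → _≈ᵀ_ {w = w} T T′ → Θ w T ≈ Θ w T′
  Θ-cong {T} {T′} T≈T′ =
    (box {T} {T′} T≈T′ , box {T′} {T} T′≈T) , (ghost {T} {T′} T≈T′ , ghost {T′} {T} T′≈T)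
    where
    T′≈T : _≈ᵀ_ {w = w} T′ T
    T′≈T r c d = sym (T≈T′ r c d)
    box : ∀ {T T′} → _≈ᵀ_ {w = w} T T′ → Box (Θ w T) ⊆ Box (Θ w T′)
    box T≈T′ {_ , c} (r , d , a≡) = r , d , trans a≡ (cong min (T≈T′ r c d))
    ghost : ∀ {T T′} → _≈ᵀ_ {w = w} T T′ → Ghost (Θ w T) ⊆ Ghost (Θ w T′)
    ghost T≈T′ {a , c} (r , d , a∈ , m<a) =
      r , d , subst (λ S → a ∈ₛ S × min S Fin.< a) (T≈T′ r c d) (a∈ , m<a)

theorem4p26 : ∀ n (w : Permutation′ n) → Avoids1432 w →
    Σ[ Θ∈KKoh ∈ (∀ T → KKoh w (Θ w T)) ]
    Σ[ compatible ∈ (∀ E → KKoh w E → ThreadCompatible w E) ]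
    Σ[ Ξ∈SVRT ∈ (∀ E (e : KKoh w E) → IsSVRT w (Ξ w E (compatible E e))) ]
    ((∀ T i → wt (Θ w T) i ≡ wtᵀ T i) ×
    IsInverse (_≈ᵀ_ {w = w}) (_≈ᴷ_ {w = w})
    (λ T → Θ w T , Θ∈KKoh T)
    (λ (E , e) → Ξ w E (compatible E e) , Ξ∈SVRT E e))
theorem4p26 n w avoids = Θ∈KKoh w , compat , Ξ∈SVRT , Θ-weight w , record
  { isLeftInverse = record
    { isCongruent = record
      { cong           = λ {T} {T′} → Θ-cong w {T} {T′}
      ; isEquivalence₁ = record
        { refl  = λ r c d → refl
        ; sym   = λ T≈T′ r c d → sym (T≈T′ r c d)
        ; trans = λ T≈T′ T′≈T″ r c d → trans (T≈T′ r c d) (T′≈T″ r c d)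
        }
      ; isEquivalence₂ = record
        { refl  = λ {(E , _)} → ≈-refl {E = E}
        ; sym   = λ {(E , _)} {(F , _)} → ≈-sym {E = E} {F}
        ; trans = λ {(E , _)} {(F , _)} {(G , _)} → ≈-trans {E = E} {F} {G}
        }
      }
    -- Both diagrams equal one `Θ w T`, so both fillings agree with this `T`.
    ; from-cong = λ {(E , e)} {(F , f)} E≈F r c d →
        let (T , F≈ΘT) = KKoh⇒Θ w avoids f in
        trans (Ξ-≡ w T (≈-trans {E = E} {F} {Θ w T} E≈F F≈ΘT) (compat E e) r c d)
              (sym (Ξ-≡ w T F≈ΘT (compat F f) r c d))
    -- `E` is the diagram of some `T₀`, which `Ξ` recovers, so `T` agrees with `T₀` and has diagram
    -- `E`.
    ; inverseˡ = λ {(E , e)} {T} T≈Ξ →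
        let (T₀ , E≈ΘT₀) = KKoh⇒Θ w avoids e in
        ≈-trans {E = Θ w T} {Θ w T₀} {E}
          (Θ-cong w {T} {T₀} (λ r c d → trans (T≈Ξ r c d) (Ξ-≡ w T₀ E≈ΘT₀ (compat E e) r c d)))
          (≈-sym {E = E} {Θ w T₀} E≈ΘT₀)
    }
  ; inverseʳ = λ {T} {(E , e)} E≈ΘT r c d → Ξ-≡ w T E≈ΘT (compat E e) r c d
  }
  where
  compat : ∀ E → KKoh w E → ThreadCompatible w E
  compat E e = let (T , E≈ΘT) = KKoh⇒Θ w avoids e in compatible w T E≈ΘT
  Ξ∈SVRT : ∀ E (e : KKoh w E) → IsSVRT w (Ξ w E (compat E e))
  Ξ∈SVRT E e = let (T , E≈ΘT) = KKoh⇒Θ w avoids e in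
    Semistandard⇒IsSVRT w (Semistandard-cong w (Ξ-≡ w T E≈ΘT (compat E e))
                                             (IsSVRT⇒Semistandard w (proj₂ T)))
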